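{- Let $G$ be a finite EPPO group. Then $\mathcal{S}(G)$ is cyclically separable if and only if either $pq$ divides $|G|$ for some primes $p > q \geq 5$, or at least two of the following three conditions hold: (i) $p$ divides $|G|$ for some prime $p \geq 5$; (ii) $3$ divides $|G|$ and $G$ has a Sylow $3$-subgroup which is not of order $3$ or is not normal in $G$; (iii) $2$ divides $|G|$ and $G$ has a Sylow $2$-subgroup which is not of order $2$ or is not normal in $G$.
   Context: A finite group is an EPPO group if every element has prime power order. All graphs are simple and undirected. For a finite group $G$, the order supergraph $\mathcal{S}(G)$ is the graph with vertex set $G$ in which two distinct vertices $x,y$ are adjacent if and only if the order of $x$ divides the order of $y$ or the order of $y$ divides the order of $x$. For a graph $\Gamma$, a vertex cutset is a set $S$ of vertices such that $\Gamma - S$ is disconnected; a cyclic vertex cutset is a vertex cutset $S$ such that $\Gamma - S$ has at least two connected components each of which contains a cycle. $\Gamma$ is called cyclically separable if it has a cyclic vertex cutset. -}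

module Defs where

open import Algebra.Bundles using (Group)
import Algebra.Definitions.RawMonoid as RawMonoidDefs
open import Data.Bool.Base using (Bool; T)
open import Data.Fin.Base using (Fin; zero; suc; inject₁; fromℕ)
open import Data.Nat.Base using (ℕ; zero; suc; _+_; _^_; _≤_; _<_)
open import Data.Nat.Divisibility using (_∣_)
open import Data.Nat.Primality using (Prime)
open import Data.Product.Base using (Σ-syntax; ∃-syntax; _×_; _,_; proj₁; proj₂)
open import Data.Sum.Base using (_⊎_; inj₁; inj₂)
open import Function.Bundles using (Func; Inverse)
open import Function.Definitions using (Injective)
open import Level using (Level; _⊔_) renaming (suc to lsuc)
open import Relation.Binary.Bundles using (Setoid)
open import Relation.Binary.Core using (Rel)
open import Relation.Binary.Definitions using (Symmetric; _Respects₂_)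
import Relation.Binary.Construct.On as On
open import Relation.Binary.Construct.Closure.ReflexiveTransitive using (Star)
open import Relation.Binary.PropositionalEquality.Core using (_≡_)
open import Relation.Binary.PropositionalEquality.Properties using (setoid)
open import Relation.Nullary.Negation.Core using (¬_)

private
  variable
    c ℓ e : Level

HasCardinality : Setoid c ℓ → ℕ → Set (c ⊔ ℓ)
HasCardinality X n = Inverse X (setoid (Fin n))

-- A subset is given by its characteristic function, which has to respect the
-- equality of X.  All the sets considered are finite, where these are the
-- subsets of classical mathematics.
Subset : Setoid c ℓ → Set (c ⊔ ℓ)
Subset X = Func X (setoid Bool)

module _ {X : Setoid c ℓ} where
  open Setoid X using (Carrier)

  infix 4 _∈_ _∉_ _⊆_

  _∈_ : Carrier → Subset X → Set
  x ∈ P = T (Func.to P x)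

  _∉_ : Carrier → Subset X → Set
  x ∉ P = ¬ (x ∈ P)

  _⊆_ : Subset X → Subset X → Set c
  P ⊆ Q = ∀ x → x ∈ P → x ∈ Q

  ⟦_⟧ : Subset X → Setoid c ℓ
  ⟦ P ⟧ = On.setoid {B = Σ[ x ∈ Carrier ] x ∈ P} X proj₁

  ∁⟦_⟧ : Subset X → Setoid c ℓ
  ∁⟦ P ⟧ = On.setoid {B = Σ[ x ∈ Carrier ] x ∉ P} X proj₁

AtLeastTwo : ∀ {a b d} → Set a → Set b → Set d → Set (a ⊔ b ⊔ d)
AtLeastTwo A B C = (A × B) ⊎ (A × C) ⊎ (B × C)

------------------------------------------------------------------------
-- Graphs

record SimpleGraph c ℓ e : Set (lsuc (c ⊔ ℓ ⊔ e)) where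
  infix 4 _~_
  field
    vertices : Setoid c ℓ
  open Setoid vertices public
    using (_≈_) renaming (Carrier to Vertex)
  field
    _~_    : Rel Vertex e
    ~-resp : _~_ Respects₂ _≈_
    ~-sym  : Symmetric _~_
    ~⇒≉    : ∀ {x y} → x ~ y → ¬ (x ≈ y)

-- The graph Γ − S.
_─_ : (Γ : SimpleGraph c ℓ e) → Subset (SimpleGraph.vertices Γ) → SimpleGraph c ℓ e
Γ ─ S = record
  { vertices = ∁⟦ S ⟧
  ; _~_      = λ x y → proj₁ x ~ proj₁ y
  ; ~-resp   = (λ eq → proj₁ ~-resp eq) , (λ eq → proj₂ ~-resp eq)
  ; ~-sym    = ~-sym
  ; ~⇒≉      = ~⇒≉
  }
  where open SimpleGraph Γ

module _ (Γ : SimpleGraph c ℓ e) where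
  open SimpleGraph Γ

  -- Two vertices are joined by a path.  A step may also replace a vertex by an
  -- equal representative, as equality of vertices is a setoid equality.
  Joined : Rel Vertex (c ⊔ ℓ ⊔ e)
  Joined = Star (λ x y → x ≈ y ⊎ x ~ y)

  Disconnected : Set (c ⊔ ℓ ⊔ e)
  Disconnected = ∃[ x ] ∃[ y ] ¬ Joined x y

  -- A cycle  v₀ ~ v₁ ~ ⋯ ~ vₖ₊₂ ~ v₀  on k + 3 distinct vertices.
  record Cycle : Set (c ⊔ ℓ ⊔ e) where
    field
      k        : ℕ
      v        : Fin (3 + k) → Vertex
      distinct : Injective _≡_ _≈_ v
      step     : ∀ (i : Fin (2 + k)) → v (inject₁ i) ~ v (suc i)
      close    : v (fromℕ (2 + k)) ~ v zero

  ComponentContainsCycle : Vertex → Set (c ⊔ ℓ ⊔ e)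
  ComponentContainsCycle x = Σ[ C ∈ Cycle ] ∀ i → Joined x (Cycle.v C i)

  -- A component is represented by any of its vertices; x and y represent
  -- different components exactly when they are not joined.
  TwoComponentsWithCycles : Set (c ⊔ ℓ ⊔ e)
  TwoComponentsWithCycles = ∃[ x ] ∃[ y ]
    ¬ Joined x y × ComponentContainsCycle x × ComponentContainsCycle y

module _ (Γ : SimpleGraph c ℓ e) where
  open SimpleGraph Γ

  IsVertexCutset : Subset vertices → Set (c ⊔ ℓ ⊔ e)
  IsVertexCutset S = Disconnected (Γ ─ S)

  IsCyclicVertexCutset : Subset vertices → Set (c ⊔ ℓ ⊔ e)
  IsCyclicVertexCutset S = IsVertexCutset S × TwoComponentsWithCycles (Γ ─ S)

  CyclicallySeparable : Set (c ⊔ ℓ ⊔ e)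
  CyclicallySeparable = ∃[ S ] IsCyclicVertexCutset S

------------------------------------------------------------------------
-- Groups

module _ (G : Group c ℓ) where
  open Group G renaming (setoid to elements)
  open RawMonoidDefs rawMonoid using () renaming (_×_ to _times_)

  infixr 8 _^ᴳ_
  _^ᴳ_ : Carrier → ℕ → Carrier
  x ^ᴳ n = n times x

  HasOrder : Carrier → ℕ → Set ℓ
  HasOrder x n = 0 < n × x ^ᴳ n ≈ ε × (∀ m → 0 < m → x ^ᴳ m ≈ ε → n ≤ m)

  -- The identity counts as an element of prime power order p ^ 0.
  EPPO : Set (c ⊔ ℓ)
  EPPO = ∀ x → ∃[ p ] ∃[ k ] Prime p × HasOrder x (p ^ k)

  OrderDivides : Rel Carrier ℓ
  OrderDivides x y = ∃[ m ] ∃[ n ] HasOrder x m × HasOrder y n × m ∣ n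

  record IsSubgroup (P : Subset elements) : Set c where
    field
      ε∈  : ε ∈ P
      ∙∈  : ∀ {x y} → x ∈ P → y ∈ P → x ∙ y ∈ P
      ⁻¹∈ : ∀ {x} → x ∈ P → x ⁻¹ ∈ P

  IsNormal : Subset elements → Set c
  IsNormal P = ∀ g {x} → x ∈ P → (g ∙ x) ∙ g ⁻¹ ∈ P

  IsPSubgroup : ℕ → Subset elements → Set (c ⊔ ℓ)
  IsPSubgroup p P = IsSubgroup P × (∀ {x} → x ∈ P → ∃[ k ] HasOrder x (p ^ k))

  -- Sylow p-subgroups are the maximal p-subgroups.
  IsSylow : ℕ → Subset elements → Set (c ⊔ ℓ)
  IsSylow p P = IsPSubgroup p P × (∀ Q → IsPSubgroup p Q → P ⊆ Q → Q ⊆ P)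

  order-resp : ∀ {x y n} → x ≈ y → HasOrder x n → HasOrder y n
  order-resp {x} {y} {n} x≈y (n>0 , xⁿ≈ε , least) =
    n>0 , trans (sym (pow n)) xⁿ≈ε ,
    λ m m>0 yᵐ≈ε → least m m>0 (trans (pow m) yᵐ≈ε)
    where
    pow : ∀ m → x ^ᴳ m ≈ y ^ᴳ m
    pow zero    = refl
    pow (suc m) = ∙-cong x≈y (pow m)

  divides-resp : ∀ {x x′ y y′} → x ≈ x′ → y ≈ y′ →
                 OrderDivides x y → OrderDivides x′ y′
  divides-resp x≈ y≈ (m , n , ox , oy , m∣n) =
    m , n , order-resp x≈ ox , order-resp y≈ oy , m∣n

  Adjacent : Rel Carrier ℓ
  Adjacent x y = ¬ (x ≈ y) × (OrderDivides x y ⊎ OrderDivides y x)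

  adjacent-resp : ∀ {x x′ y y′} → x ≈ x′ → y ≈ y′ → Adjacent x y → Adjacent x′ y′
  adjacent-resp x≈ y≈ (x≉y , inj₁ d) =
    (λ eq → x≉y (trans x≈ (trans eq (sym y≈)))) , inj₁ (divides-resp x≈ y≈ d)
  adjacent-resp x≈ y≈ (x≉y , inj₂ d) =
    (λ eq → x≉y (trans x≈ (trans eq (sym y≈)))) , inj₂ (divides-resp y≈ x≈ d)

  adjacent-sym : Symmetric Adjacent
  adjacent-sym (x≉y , inj₁ d) = (λ eq → x≉y (sym eq)) , inj₂ d
  adjacent-sym (x≉y , inj₂ d) = (λ eq → x≉y (sym eq)) , inj₁ d

  OrderSupergraph : SimpleGraph c ℓ ℓ
  OrderSupergraph = record
    { vertices = elements
    ; _~_      = Adjacent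
    ; ~-resp   = (λ y≈ → adjacent-resp refl y≈) , (λ x≈ → adjacent-resp x≈ refl)
    ; ~-sym    = adjacent-sym
    ; ~⇒≉      = proj₁
    }

{-# OPTIONS --safe #-}
module Submission where

-- In an EPPO group, S(G) without the identity is a disjoint union of cliques,
-- one for each prime p dividing |G|, formed by the non-identity p-elements.  The
-- identity is adjacent to everything, so it lies in every cutset, and S(G) is
-- cyclically separable exactly when two of these cliques have at least three
-- elements.  For p ≥ 5 Cauchy's theorem provides them; for p = 2 and p = 3 they
-- exist unless the p-elements form a normal Sylow subgroup of order p, because a
-- normal Sylow p-subgroup P contains every p-element y: P⟨y⟩ is a p-subgroup.

open import Defs
open import Algebra.Bundles using (Group)
import Algebra.Properties.Group as GroupProperties
import Algebra.Properties.Monoid.Mult as MonoidMult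
open import Data.Bool.Base using (true; T)
open import Data.Bool.Properties using (T?; T-≡)
open import Data.Fin.Base as Fin using (Fin; zero; suc; toℕ; fromℕ<)
import Data.Fin.Properties as Fin
open import Data.Fin.Subset as FinSubset using (_⊃_)
open import Data.Fin.Subset.Induction using (⊃-wellFounded)
open import Data.Fin.Subset.Properties using (anySubset?; _⊂?_)
open import Data.List.Base
  using (List; []; _∷_; [_]; _++_; length; map; replicate; allFin; applyUpTo; cartesianProductWith)
open import Data.List.Membership.Propositional using (find; lose) renaming (_∈_ to _∈ˡ_; _∉_ to _∉ˡ_)
open import Data.List.Membership.Propositional.Properties
  using (∈-∃++; ∈-++⁺ʳ; ∈-++⁻; ∈-map⁺; ∈-map⁻; ∈-allFin; ∈-applyUpTo⁺; ∈-applyUpTo⁻;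
         ∈-cartesianProductWith⁺; ∈-cartesianProductWith⁻)
open import Data.List.Properties
  using (++-assoc; ++-identityʳ; length-applyUpTo; length-map; length-++; length-replicate;
         length-tabulate; ∷ʳ-injective; ∷-injectiveˡ; ∷-injectiveʳ; ≡-dec)
open import Data.List.Relation.Binary.Permutation.Propositional
  using (_↭_; ↭-refl; ↭-sym; ↭-trans; ↭⇒↭ₛ)
open import Data.List.Relation.Binary.Permutation.Propositional.Properties
  using (∈-resp-↭; ↭-length; shift; ++⁺ˡ)
import Data.List.Relation.Binary.Permutation.Setoid.Properties as PermutationSetoid
import Data.List.Relation.Unary.All as All
open import Data.List.Relation.Unary.AllPairs using ([]; _∷_)
open import Data.List.Relation.Unary.Any using (here; there; any?)
open import Data.List.Relation.Unary.Unique.Propositional using (Unique)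
import Data.List.Relation.Unary.Unique.Propositional.Properties as Unique
open import Data.Nat.Base
  using (ℕ; zero; suc; _+_; _*_; _∸_; _^_; _≤_; _<_; _>_; _≥_; z<s; s≤s; NonZero;
         >-nonZero; >-nonZero⁻¹; nonTrivial⇒n>1)
open import Data.Nat.Coprimality using (Coprime; coprime-Bézout; prime⇒coprime)
open import Data.Nat.Divisibility
open import Data.Nat.DivMod using (_/_; _%_; m≡m%n+[m/n]*n; m%n<n)
open import Data.Nat.GCD using (module Bézout)
open import Data.Nat.GeneralisedArithmetic using (fold; fold-+)
open import Data.Nat.Induction using (<-wellFounded)
open import Data.Nat.Primality
import Data.Nat.Properties as ℕ
open import Data.Product.Base using (Σ; ∃-syntax; _×_; _,_; proj₁; proj₂; -,_)
open import Data.Sum.Base as Sum using (_⊎_; inj₁; inj₂; [_,_]′)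
open import Data.Unit.Base using (tt)
open import Data.Vec.Base using (tabulate; lookup)
open import Data.Vec.Functional using () renaming (_∷_ to _◂_; [] to ⟨⟩)
open import Data.Vec.Properties using (lookup∘tabulate; []=⇒lookup; lookup⇒[]=)
open import Function.Base using (_∘_; id)
open import Function.Bundles using (Func; Inverse; Equivalence; mk⇔; _⇔_)
open import Function.Definitions using (Injective)
open import Induction.WellFounded using (Acc; acc)
open import Relation.Binary.Construct.Closure.ReflexiveTransitive
  using (_◅_; _◅◅_; reverse) renaming (ε to nil)
open import Relation.Binary.Definitions using (tri<; tri≈; tri>)
open import Relation.Binary.PropositionalEquality as ≡ using (_≡_; _≢_; refl; cong; cong₂; subst)
open import Relation.Nullary.Decidable
  using (Dec; yes; no; ⌊_⌋; map′; ¬?; _×-dec_; _→-dec_; toWitness; toWitnessFalse; fromWitness;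
         isYes≗does; does-⇔; decidable-stable)
open import Relation.Nullary.Negation.Core using (¬_; contradiction)

-- Orbits of maps of prime order

-- Three is the length of a shortest cycle, and this singles out the small primes. An element of
-- order p has p - 1 non-identity powers: at least four for p ≥ 5, but two for p = 3 and one for p =
-- 2. For p = 3 one further 3-element is therefore wanted. A Sylow subgroup that is too large
-- contains one, and one that is not normal has a conjugate element outside it. For p = 2 the same
-- argument yields only two elements, and the third is built from them as a conjugate, a product or
-- a square. One counting lemma serves twice: rotation of words gives Cauchy's theorem, and left
-- translation gives the converse, that p divides |G| once there is a non-identity p-element. The
-- alternatives (normal or not, maximal or not) must be decided constructively. Finiteness reduces
-- them to searches over `Fin n`; being a p-element involves an unbounded exponent and is decided
-- through the prime that EPPO attaches to each element.

module _ {a} {A : Set a} where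

  -- Since `ys` has no repetitions, its head is not among the later entries, so it is found in the
  -- complement of those and can be moved out of it.
  ++-complement : ∀ {xs} (ys : List A) → Unique ys → (∀ {y} → y ∈ˡ ys → y ∈ˡ xs) →
                  ∃[ zs ] xs ↭ ys ++ zs
  ++-complement {xs} []       []          _   = xs , ↭-refl
  ++-complement      (y ∷ ys) u@(_ ∷ uys) sub
    with zs , eq ← ++-complement ys uys (sub ∘ there)
    with ∈-++⁻ ys (∈-resp-↭ eq (sub (here refl)))
  ... | inj₁ y∈ys = contradiction y∈ys (Unique.Unique[x∷xs]⇒x∉xs u)
  ... | inj₂ y∈zs with as , bs , refl ← ∈-∃++ y∈zs =
    as ++ bs , ↭-trans eq (↭-trans (++⁺ˡ ys (shift y as bs)) (shift y ys (as ++ bs)))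

  unique-++⁻ : ∀ (ys : List A) {zs} → Unique (ys ++ zs) →
               Unique zs × (∀ {z} → z ∈ˡ ys → z ∉ˡ zs)
  unique-++⁻ []       u        = u , λ ()
  unique-++⁻ (y ∷ ys) {zs} u@(_ ∷ u′) with uzs , dis ← unique-++⁻ ys u′ =
    uzs , λ { (here refl) z∈zs → Unique.Unique[x∷xs]⇒x∉xs u (∈-++⁺ʳ ys z∈zs)
            ; (there z∈)  → dis z∈ }

  unique-resp-↭ : ∀ {xs ys : List A} → xs ↭ ys → Unique xs → Unique ys
  unique-resp-↭ eq = PermutationSetoid.Unique-resp-↭ (≡.setoid A) (↭⇒↭ₛ eq)

module _ {a} {A : Set a} (f : A → A) where

  fold-suc : ∀ x n → fold (f x) f n ≡ f (fold x f n)
  fold-suc x zero    = refl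
  fold-suc x (suc n) = cong f (fold-suc x n)

  fold-*-fixed : ∀ {x} k n → fold x f n ≡ x → fold x f (k * n) ≡ x
  fold-*-fixed     zero    n eq = refl
  fold-*-fixed {x} (suc k) n eq = begin
    fold x f (n + k * n)          ≡⟨ fold-+ x f n ⟩
    fold (fold x f (k * n)) f n   ≡⟨ cong (λ y → fold y f n) (fold-*-fixed k n eq) ⟩
    fold x f n                    ≡⟨ eq ⟩
    x                             ∎
    where open ≡.≡-Reasoning

  -- By Bézout some multiple of one period is one more than a multiple of the other. Both signs are
  -- treated in natural numbers, as `f` comes without an inverse.
  fold-coprime-fixed : ∀ {x m n} → Coprime m n → fold x f m ≡ x → fold x f n ≡ x → f x ≡ x
  fold-coprime-fixed {x} {m} {n} c fᵐ fⁿ with coprime-Bézout c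
  ... | Bézout.+- k l eq = begin
    f x                    ≡⟨ cong f (fold-*-fixed l n fⁿ) ⟨
    fold x f (1 + l * n)   ≡⟨ cong (fold x f) eq ⟩
    fold x f (k * m)       ≡⟨ fold-*-fixed k m fᵐ ⟩
    x                      ∎
    where open ≡.≡-Reasoning
  ... | Bézout.-+ k l eq = begin
    f x                    ≡⟨ cong f (fold-*-fixed k m fᵐ) ⟨
    fold x f (1 + k * m)   ≡⟨ cong (fold x f) eq ⟩
    fold x f (l * n)       ≡⟨ fold-*-fixed l n fⁿ ⟩
    x                      ∎
    where open ≡.≡-Reasoning

  fold-% : ∀ {x} p .{{_ : NonZero p}} m → fold x f p ≡ x → fold x f m ≡ fold x f (m % p)
  fold-% {x} p m fᵖ = begin
    fold x f m                               ≡⟨ cong (fold x f) (m≡m%n+[m/n]*n m p) ⟩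
    fold x f (m % p + (m / p) * p)           ≡⟨ fold-+ x f (m % p) ⟩
    fold (fold x f ((m / p) * p)) f (m % p)  ≡⟨ cong (λ y → fold y f (m % p)) (fold-*-fixed (m / p) p fᵖ) ⟩
    fold x f (m % p)                         ∎
    where open ≡.≡-Reasoning

  -- From a coincidence at steps i and j, another p - i steps lead back to x, so j - i is a period
  -- as well. It is coprime to p, and x would be fixed.
  fold-distinct : ∀ {x p} → Prime p → fold x f p ≡ x → f x ≢ x →
                  ∀ {i j} → i < j → j < p → fold x f i ≢ fold x f j
  fold-distinct {x} {p} pp fᵖ fx≢x {i} {j} i<j j<p fⁱ≡fʲ =
    fx≢x (fold-coprime-fixed (prime⇒coprime pp d<p) fᵖ (begin
      fold x f (j ∸ i)                 ≡⟨ cong (λ y → fold y f (j ∸ i)) fᵖ ⟨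
      fold (fold x f p) f (j ∸ i)      ≡⟨ fold-+ x f (j ∸ i) ⟨
      fold x f (j ∸ i + p)             ≡⟨ cong (fold x f) shuffle ⟩
      fold x f (p ∸ i + j)             ≡⟨ fold-+ x f (p ∸ i) ⟩
      fold (fold x f j) f (p ∸ i)      ≡⟨ cong (λ y → fold y f (p ∸ i)) fⁱ≡fʲ ⟨
      fold (fold x f i) f (p ∸ i)      ≡⟨ fold-+ x f (p ∸ i) ⟨
      fold x f (p ∸ i + i)             ≡⟨ cong (fold x f) (ℕ.m∸n+n≡m i≤p) ⟩
      fold x f p                       ≡⟨ fᵖ ⟩
      x                                ∎))
    where
    open ≡.≡-Reasoning
    i≤p : i ≤ p
    i≤p = ℕ.<⇒≤ (ℕ.<-trans i<j j<p)
    instance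
      d≢0 : NonZero (j ∸ i)
      d≢0 = >-nonZero (ℕ.m<n⇒0<n∸m i<j)
    d<p : j ∸ i < p
    d<p = ℕ.≤-<-trans (ℕ.m∸n≤m j i) j<p
    shuffle : j ∸ i + p ≡ p ∸ i + j
    shuffle = begin
      j ∸ i + p   ≡⟨ ℕ.+-∸-comm p (ℕ.<⇒≤ i<j) ⟨
      (j + p) ∸ i ≡⟨ cong (_∸ i) (ℕ.+-comm j p) ⟩
      (p + j) ∸ i ≡⟨ ℕ.+-∸-comm j i≤p ⟩
      p ∸ i + j   ∎

  orbit⊆ : ∀ {x xs} → (∀ {y} → y ∈ˡ xs → f y ∈ˡ xs) → ∀ n → x ∈ˡ xs →
           ∀ {y} → y ∈ˡ applyUpTo (fold x f) n → y ∈ˡ xs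
  orbit⊆ {x} {xs} closed n x∈xs y∈ with i , _ , refl ← ∈-applyUpTo⁻ (fold x f) y∈ = fold∈ i
    where
    fold∈ : ∀ i → fold x f i ∈ˡ xs
    fold∈ zero    = x∈xs
    fold∈ (suc i) = closed (fold∈ i)

  -- The list splits into orbits, each of size p.
  prime∣length : ∀ {p} → Prime p → (xs : List A) → Unique xs →
                 (∀ {x} → x ∈ˡ xs → f x ∈ˡ xs) →
                 (∀ {x} → x ∈ˡ xs → fold x f p ≡ x) →
                 (∀ {x} → x ∈ˡ xs → f x ≢ x) →
                 p ∣ length xs
  prime∣length {p} pp xs = go xs (<-wellFounded _)
    where
    instance
      p≢0 : NonZero p
      p≢0 = prime⇒nonZero pp

    go : ∀ xs → Acc _<_ (length xs) → Unique xs →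
         (∀ {x} → x ∈ˡ xs → f x ∈ˡ xs) →
         (∀ {x} → x ∈ˡ xs → fold x f p ≡ x) →
         (∀ {x} → x ∈ˡ xs → f x ≢ x) →
         p ∣ length xs
    go []       _         _ _      _  _     = p ∣0
    go xs@(x ∷ _) (acc rec) u closed fᵖ moves
      with zs , xs↭ ← ++-complement (applyUpTo (fold x f) p)
                        (Unique.applyUpTo⁺₁ _ p (fold-distinct pp (fᵖ (here refl)) (moves (here refl))))
                        (orbit⊆ closed p (here refl))
      with uzs , disjoint ← unique-++⁻ (applyUpTo (fold x f) p) (unique-resp-↭ xs↭ u)
      = subst (p ∣_) (≡.sym len) (∣m∣n⇒∣m+n ∣-refl
        (go zs (rec shorter) uzs closed′ (fᵖ ∘ zs⊆) (moves ∘ zs⊆)))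
      where
      orbit = applyUpTo (fold x f) p
      len : length xs ≡ p + length zs
      len = ≡.trans (↭-length xs↭) (≡.trans (length-++ orbit)
              (cong (_+ length zs) (length-applyUpTo (fold x f) p)))
      shorter : length zs < length xs
      shorter = subst (length zs <_) (≡.sym len) (ℕ.m<n+m (length zs) (>-nonZero⁻¹ p))
      zs⊆ : ∀ {z} → z ∈ˡ zs → z ∈ˡ xs
      zs⊆ z∈ = ∈-resp-↭ (↭-sym xs↭) (∈-++⁺ʳ orbit z∈)
      fold∈orbit : ∀ m → fold x f m ∈ˡ orbit
      fold∈orbit m = subst (_∈ˡ orbit) (≡.sym (fold-% p m (fᵖ (here refl))))
                       (∈-applyUpTo⁺ (fold x f) (m%n<n m p))
      -- The orbit is also closed backwards: z is reached from `f z` by p - 1 further steps, so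
      -- `f z` on the orbit would put z there too.
      pred-orbit : ∀ {z} → z ∈ˡ zs → f z ∉ˡ orbit
      pred-orbit {z} z∈zs fz∈ with i , _ , fz≡ ← ∈-applyUpTo⁻ (fold x f) fz∈ =
        disjoint (subst (_∈ˡ orbit) eq (fold∈orbit (p ∸ 1 + i))) z∈zs
        where
        open ≡.≡-Reasoning
        eq : fold x f (p ∸ 1 + i) ≡ z
        eq = begin
          fold x f (p ∸ 1 + i)           ≡⟨ fold-+ x f (p ∸ 1) ⟩
          fold (fold x f i) f (p ∸ 1)    ≡⟨ cong (λ y → fold y f (p ∸ 1)) fz≡ ⟨
          fold (f z) f (p ∸ 1)           ≡⟨ fold-suc z (p ∸ 1) ⟩
          fold z f (suc (p ∸ 1))         ≡⟨ cong (fold z f) (ℕ.m+[n∸m]≡n (>-nonZero⁻¹ p)) ⟩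
          fold z f p                     ≡⟨ fᵖ (zs⊆ z∈zs) ⟩
          z                              ∎
      closed′ : ∀ {z} → z ∈ˡ zs → f z ∈ˡ zs
      closed′ z∈zs with ∈-++⁻ orbit (∈-resp-↭ xs↭ (closed (zs⊆ z∈zs)))
      ... | inj₁ fz∈ = contradiction fz∈ (pred-orbit z∈zs)
      ... | inj₂ fz∈ = fz∈

-- Words and primes

module _ {a} {A : Set a} where

  rotate : List A → List A
  rotate []       = []
  rotate (x ∷ xs) = xs ++ [ x ]

  length-rotate : ∀ xs → length (rotate xs) ≡ length xs
  length-rotate []       = refl
  length-rotate (x ∷ xs) = ≡.trans (length-++ xs) (ℕ.+-comm (length xs) 1)

  -- The suffix `ys` collects the letters already rotated, which lets the induction on `xs` go
  -- through.
  fold-rotate : ∀ xs ys → fold (xs ++ ys) rotate (length xs) ≡ ys ++ xs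
  fold-rotate []       ys = ≡.sym (++-identityʳ ys)
  fold-rotate (x ∷ xs) ys = begin
    rotate (fold (x ∷ xs ++ ys) rotate (length xs)) ≡⟨ fold-suc rotate (x ∷ xs ++ ys) (length xs) ⟨
    fold ((xs ++ ys) ++ [ x ]) rotate (length xs)   ≡⟨ cong (λ w → fold w rotate (length xs)) (++-assoc xs ys [ x ]) ⟩
    fold (xs ++ (ys ++ [ x ])) rotate (length xs)   ≡⟨ fold-rotate xs (ys ++ [ x ]) ⟩
    (ys ++ [ x ]) ++ xs                             ≡⟨ ++-assoc ys [ x ] xs ⟩
    ys ++ (x ∷ xs)                                  ∎
    where open ≡.≡-Reasoning

  fold-rotate-length : ∀ xs → fold xs rotate (length xs) ≡ xs
  fold-rotate-length xs =
    ≡.trans (cong (λ w → fold w rotate (length xs)) (≡.sym (++-identityʳ xs))) (fold-rotate xs [])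

  -- The equation says that `x ∷ xs` is fixed by `rotate`: every letter equals the one before it.
  ∷ʳ≡∷⇒replicate : ∀ (xs : List A) {x} → xs ++ [ x ] ≡ x ∷ xs → xs ≡ replicate (length xs) x
  ∷ʳ≡∷⇒replicate []       eq = refl
  ∷ʳ≡∷⇒replicate (y ∷ xs) eq with refl ← ∷-injectiveˡ eq =
    cong (y ∷_) (∷ʳ≡∷⇒replicate xs (∷-injectiveʳ eq))

  replicate-∷ʳ : ∀ k (x : A) → replicate k x ++ [ x ] ≡ x ∷ replicate k x
  replicate-∷ʳ zero    x = refl
  replicate-∷ʳ (suc k) x = cong (x ∷_) (replicate-∷ʳ k x)

  rotate≡replicate : ∀ k (w : List A) {x} → rotate w ≡ replicate (suc k) x → w ≡ replicate (suc k) x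
  rotate≡replicate k (y ∷ w) {x} eq
    with refl , refl ← ∷ʳ-injective w (replicate k x) (≡.trans eq (≡.sym (replicate-∷ʳ k x))) = refl

length-cartesianProductWith :
  ∀ {a b c} {A : Set a} {B : Set b} {C : Set c} (f : A → B → C) xs ys →
  length (cartesianProductWith f xs ys) ≡ length xs * length ys
length-cartesianProductWith f []       ys = refl
length-cartesianProductWith f (x ∷ xs) ys = ≡.trans (length-++ (map (f x) ys))
  (cong₂ _+_ (length-map (f x) ys) (length-cartesianProductWith f xs ys))

words : ∀ n → ℕ → List (List (Fin n))
words n zero    = [ [] ]
words n (suc k) = cartesianProductWith _∷_ (allFin n) (words n k)

length-words : ∀ n k → length (words n k) ≡ n ^ k
length-words n zero    = refl
length-words n (suc k) = ≡.trans (length-cartesianProductWith _∷_ (allFin n) (words n k))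
  (cong₂ _*_ (length-tabulate {n = n} id) (length-words n k))

unique-words : ∀ n k → Unique (words n k)
unique-words n zero    = All.[] ∷ []
unique-words n (suc k) = Unique.cartesianProductWith⁺ _∷_
  (λ eq → ∷-injectiveˡ eq , ∷-injectiveʳ eq) (Unique.allFin⁺ n) (unique-words n k)

∈-words⁺ : ∀ {n} (w : List (Fin n)) → w ∈ˡ words n (length w)
∈-words⁺ []      = here refl
∈-words⁺ (i ∷ w) = ∈-cartesianProductWith⁺ _∷_ (∈-allFin i) (∈-words⁺ w)

∈-words⁻ : ∀ n k {w} → w ∈ˡ words n k → length w ≡ k
∈-words⁻ n zero    (here refl) = refl
∈-words⁻ n (suc k) w∈
  with _ , _ , _ , w′∈ , refl ← ∈-cartesianProductWith⁻ _∷_ (allFin n) (words n k) w∈ =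
  cong suc (∈-words⁻ n k w′∈)

prime≢1 : ∀ {p} → Prime p → p ≢ 1
prime≢1 pp refl = contradiction pp ¬prime[1]

prime∣^⇒∣ : ∀ {p} → Prime p → ∀ m k → p ∣ m ^ k → p ∣ m
prime∣^⇒∣ pp m zero    p∣1 = contradiction (∣1⇒≡1 p∣1) (prime≢1 pp)
prime∣^⇒∣ pp m (suc k) p∣  = [ id , prime∣^⇒∣ pp m k ]′ (euclidsLemma m (m ^ k) pp p∣)

prime∣prime⇒≡ : ∀ {p q} → Prime p → Prime q → p ∣ q → p ≡ q
prime∣prime⇒≡ pp qq p∣q = [ (λ p≡1 → contradiction p≡1 (prime≢1 pp)) , id ]′ (prime⇒irreducible qq p∣q)

∣-^-mono : ∀ p {i j} → i ≤ j → p ^ i ∣ p ^ j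
∣-^-mono p {i} i≤j with k , refl ← ℕ.m≤n⇒∃[o]m+o≡n i≤j =
  subst (p ^ i ∣_) (≡.sym (ℕ.^-distribˡ-+-* p i k)) (m∣m*n (p ^ k))

-- Powers and orders

module Powers {c ℓ} (G : Group c ℓ) where
  open Group G renaming (refl to ≈-refl; sym to ≈-sym; trans to ≈-trans)
  open MonoidMult monoid using (×-congʳ; ×-congˡ; ×-homo-+; ×-assocˡ)
  open import Relation.Binary.Reasoning.Setoid setoid

  infixr 8 _↑_
  _↑_ : Carrier → ℕ → Carrier
  _↑_ = _^ᴳ_ G

  ↑-congˡ : ∀ {x y} n → x ≈ y → x ↑ n ≈ y ↑ n
  ↑-congˡ n = ×-congʳ n

  ε↑ : ∀ n → ε ↑ n ≈ ε
  ε↑ zero    = ≈-refl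
  ε↑ (suc n) = ≈-trans (identityˡ _) (ε↑ n)

  ↑1 : ∀ x → x ↑ 1 ≈ x
  ↑1 = identityʳ

  ↑-* : ∀ x m n → x ↑ (m * n) ≈ (x ↑ n) ↑ m
  ↑-* x m n = ≈-sym (×-assocˡ x m n)

  ↑-+ : ∀ x m n → x ↑ (m + n) ≈ x ↑ m ∙ x ↑ n
  ↑-+ = ×-homo-+

  ↑-∣ : ∀ {x m n} → m ∣ n → x ↑ m ≈ ε → x ↑ n ≈ ε
  ↑-∣ {x} {m} (divides-refl k) eq = ≈-trans (↑-* x k m) (≈-trans (↑-congˡ k eq) (ε↑ k))

  ↑-coprime : ∀ {x m n} → Coprime m n → x ↑ m ≈ ε → x ↑ n ≈ ε → x ≈ ε
  ↑-coprime {x} {m} {n} cop xᵐ xⁿ with coprime-Bézout cop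
  ... | Bézout.+- k l eq = begin
    x                 ≈⟨ identityʳ x ⟨
    x ∙ ε             ≈⟨ ∙-congˡ (↑-∣ (n∣m*n l) xⁿ) ⟨
    x ↑ (1 + l * n)   ≈⟨ ×-congˡ eq ⟩
    x ↑ (k * m)       ≈⟨ ↑-∣ (n∣m*n k) xᵐ ⟩
    ε                 ∎
  ... | Bézout.-+ k l eq = begin
    x                 ≈⟨ identityʳ x ⟨
    x ∙ ε             ≈⟨ ∙-congˡ (↑-∣ (n∣m*n k) xᵐ) ⟨
    x ↑ (1 + k * m)   ≈⟨ ×-congˡ eq ⟩
    x ↑ (l * n)       ≈⟨ ↑-∣ (n∣m*n l) xⁿ ⟩
    ε                 ∎

  ↑-% : ∀ {x} m .{{_ : NonZero m}} n → x ↑ m ≈ ε → x ↑ n ≈ x ↑ (n % m)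
  ↑-% {x} m n xᵐ = begin
    x ↑ n                                ≈⟨ ×-congˡ (m≡m%n+[m/n]*n n m) ⟩
    x ↑ (n % m + (n / m) * m)            ≈⟨ ↑-+ x (n % m) _ ⟩
    x ↑ (n % m) ∙ x ↑ ((n / m) * m)      ≈⟨ ∙-congˡ (↑-∣ (n∣m*n (n / m)) xᵐ) ⟩
    x ↑ (n % m) ∙ ε                      ≈⟨ identityʳ _ ⟩
    x ↑ (n % m)                          ∎

  order-∣ : ∀ {x m n} → HasOrder G x m → x ↑ n ≈ ε → m ∣ n
  order-∣ {x} {m} {n} (m>0 , xᵐ , least) xⁿ = m%n≡0⇒n∣m n m (zero-% (n % m) refl)
    where
    instance
      m≢0 : NonZero m
      m≢0 = >-nonZero m>0
    zero-% : ∀ r → n % m ≡ r → n % m ≡ 0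
    zero-% zero    eq = eq
    zero-% (suc r) eq = contradiction
      (least (n % m) (subst (0 <_) (≡.sym eq) z<s) (≈-trans (≈-sym (↑-% m n xᵐ)) xⁿ))
      (ℕ.<⇒≱ (m%n<n n m))

-- Finite groups: decidable equality, Cauchy's theorem and its converse

module Finite {c ℓ} (G : Group c ℓ) {n} (card : HasCardinality (Group.setoid G) n) where
  open Group G renaming (refl to ≈-refl; sym to ≈-sym; trans to ≈-trans)
  open Powers G
  open GroupProperties G using (inverseˡ-unique; identityˡ-unique)
  open Inverse card using (to; from; to-cong; from-cong; strictlyInverseˡ; strictlyInverseʳ)
  open import Relation.Binary.Reasoning.Setoid setoid

  infix 4 _≟_
  _≟_ : ∀ x y → Dec (x ≈ y)
  x ≟ y = map′ (λ eq → ≈-trans (≈-sym (strictlyInverseʳ x)) (≈-trans (from-cong eq) (strictlyInverseʳ y)))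
               to-cong (to x Fin.≟ to y)

  search : ∀ {a} {P : Carrier → Set a} → (∀ {x y} → x ≈ y → P x → P y) →
           (∀ x → Dec (P x)) → Dec (∃[ x ] P x)
  search resp P? = map′ (λ (i , p) → from i , p)
                        (λ (x , p) → to x , resp (≈-sym (strictlyInverseʳ x)) p)
                        (Fin.any? (P? ∘ from))

  private
    prod : List (Fin n) → Carrier
    prod []      = ε
    prod (i ∷ w) = from i ∙ prod w

    prod-rotate : ∀ w → prod w ≈ ε → prod (rotate w) ≈ ε
    prod-rotate []      eq = eq
    prod-rotate (i ∷ w) eq = begin
      prod (w ++ [ i ])                  ≈⟨ prod-∷ʳ w ⟩
      prod w ∙ from i                    ≈⟨ ∙-congˡ (inverseˡ-unique _ _ eq) ⟩
      prod w ∙ prod w ⁻¹                 ≈⟨ inverseʳ _ ⟩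
      ε                                  ∎
      where
      prod-∷ʳ : ∀ w → prod (w ++ [ i ]) ≈ prod w ∙ from i
      prod-∷ʳ []      = ≈-trans (identityʳ _) (≈-sym (identityˡ _))
      prod-∷ʳ (j ∷ w) = ≈-trans (∙-congˡ (prod-∷ʳ w)) (≈-sym (assoc _ _ _))

    prod-replicate : ∀ k i → prod (replicate k i) ≈ from i ↑ k
    prod-replicate zero    i = ≈-refl
    prod-replicate (suc k) i = ∙-congˡ (prod-replicate k i)

    -- In a word with product ε the first letter is determined by the others. Words of length k + 1
    -- with product ε thus correspond to arbitrary words of length k, which makes their number n ^
    -- k.
    close : List (Fin n) → List (Fin n)
    close w = to (prod w ⁻¹) ∷ w

    relators : ℕ → List (List (Fin n))
    relators k = map close (words n k)

    ∈-relators⁻ : ∀ k {w} → w ∈ˡ relators k → length w ≡ suc k × prod w ≈ ε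
    ∈-relators⁻ k w∈ with w , w∈words , refl ← ∈-map⁻ close w∈ =
      cong suc (∈-words⁻ n k w∈words) ,
      ≈-trans (∙-congʳ (strictlyInverseʳ _)) (inverseˡ _)

    ∈-relators⁺ : ∀ k w → length w ≡ suc k → prod w ≈ ε → w ∈ˡ relators k
    ∈-relators⁺ k (i ∷ w) refl eq =
      subst (λ j → j ∷ w ∈ˡ relators k) to-prod (∈-map⁺ close (∈-words⁺ w))
      where
      to-prod : to (prod w ⁻¹) ≡ i
      to-prod = ≡.trans (to-cong (≈-sym (inverseˡ-unique _ _ eq))) (strictlyInverseˡ i)

  -- McKay's argument: rotation acts on the p-tuples with product ε, and its
  -- fixed points are the constant tuples.
  cauchy : ∀ {p} → Prime p → p ∣ n → ∃[ x ] ¬ (x ≈ ε) × x ↑ p ≈ ε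
  cauchy {zero}        pp _ = contradiction pp ¬prime[0]
  cauchy {suc zero}    pp _ = contradiction pp ¬prime[1]
  cauchy {p@(suc k@(suc k-1))} pp p∣n = fixed-exists
    where
    trivial : List (Fin n)
    trivial = replicate p (to ε)

    trivial∈ : trivial ∈ˡ relators k
    trivial∈ = ∈-relators⁺ k trivial (length-replicate p)
      (≈-trans (prod-replicate p (to ε)) (≈-trans (↑-congˡ p (strictlyInverseʳ ε)) (ε↑ p)))

    split : ∃[ zs ] relators k ↭ [ trivial ] ++ zs
    split = ++-complement [ trivial ] (All.[] ∷ []) λ { (here refl) → trivial∈ }

    rest : List (List (Fin n))
    rest = proj₁ split

    unique-split : Unique rest × (∀ {z} → z ∈ˡ [ trivial ] → z ∉ˡ rest)
    unique-split = unique-++⁻ [ trivial ] (unique-resp-↭ (proj₂ split)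
      (Unique.map⁺ ∷-injectiveʳ (unique-words n k)))

    rest⊆ : ∀ {w} → w ∈ˡ rest → w ∈ˡ relators k
    rest⊆ w∈ = ∈-resp-↭ (↭-sym (proj₂ split)) (there w∈)

    fold-rest : ∀ {w} → w ∈ˡ rest → fold w rotate p ≡ w
    fold-rest {w} w∈ = subst (λ m → fold w rotate m ≡ w)
      (proj₁ (∈-relators⁻ k (rest⊆ w∈))) (fold-rotate-length w)

    closed : ∀ {w} → w ∈ˡ rest → rotate w ∈ˡ rest
    closed {w} w∈ with len , eq ← ∈-relators⁻ k (rest⊆ w∈)
      with ∈-resp-↭ (proj₂ split)
             (∈-relators⁺ k (rotate w) (≡.trans (length-rotate w) len) (prod-rotate w eq))
    ... | there rw∈ = rw∈
    ... | here rw≡  = contradiction w∈ (proj₂ unique-split (here (rotate≡replicate k w rw≡)))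

    fixed-word : ∀ w → w ∈ˡ rest → rotate w ≡ w → ∃[ x ] ¬ (x ≈ ε) × x ↑ p ≈ ε
    fixed-word w w∈ rot with ∈-relators⁻ k (rest⊆ w∈)
    fixed-word (i ∷ w) iw∈ rot | len , eq = from i , nontrivial , power
      where
      w≡ : w ≡ replicate k i
      w≡ = subst (λ m → w ≡ replicate m i) (ℕ.suc-injective len) (∷ʳ≡∷⇒replicate w rot)
      power : from i ↑ p ≈ ε
      power = ≈-trans (≈-sym (prod-replicate p i)) (subst (λ v → prod (i ∷ v) ≈ ε) w≡ eq)
      nontrivial : ¬ (from i ≈ ε)
      nontrivial fi≈ε = proj₂ unique-split (here (cong₂ _∷_ i≡ (≡.trans w≡ (cong (replicate k) i≡)))) iw∈
        where
        i≡ : i ≡ to ε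
        i≡ = ≡.trans (≡.sym (strictlyInverseˡ i)) (to-cong fi≈ε)

    length-rest : n ^ k ≡ 1 + length rest
    length-rest = ≡.trans (≡.sym (≡.trans (length-map close (words n k)) (length-words n k)))
                    (↭-length (proj₂ split))

    fixed-exists : ∃[ x ] ¬ (x ≈ ε) × x ↑ p ≈ ε
    fixed-exists with any? (λ w → ≡-dec Fin._≟_ (rotate w) w) rest
    ... | yes fixed with w , w∈ , rot ← find fixed = fixed-word w w∈ rot
    -- Without a fixed word p divides the length of `rest`. It also divides n ^ k, where k = p - 1 ≥
    -- 1, and the two numbers differ by one because only the constant word of identities was set
    -- aside.
    ... | no moving = contradiction
      (∣1⇒≡1 (∣m+n∣m⇒∣n
        (subst (p ∣_) (≡.trans length-rest (ℕ.+-comm 1 _)) (∣m⇒∣m*n (n ^ k-1) p∣n))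
        (prime∣length rotate pp rest (proj₁ unique-split) closed fold-rest
          (λ w∈ rot → moving (lose w∈ rot)))))
      (prime≢1 pp)

  -- Left translation by x moves every element, and its p-th iterate is the identity map, so the
  -- orbit count applies to the whole group.
  translation-order∣card : ∀ {p} → Prime p → ∀ {x} → ¬ (x ≈ ε) → x ↑ p ≈ ε → p ∣ n
  translation-order∣card {p} pp {x} x≉ε xᵖ = subst (p ∣_) (length-tabulate id)
    (prime∣length translate pp (allFin n) (Unique.allFin⁺ n) (λ _ → ∈-allFin _) (λ {i} _ → translateᵖ i) moves)
    where
    translate : Fin n → Fin n
    translate i = to (x ∙ from i)
    fold-translate : ∀ m i → fold i translate m ≡ to (x ↑ m ∙ from i)
    fold-translate zero    i = ≡.trans (≡.sym (strictlyInverseˡ i)) (to-cong (≈-sym (identityˡ _)))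
    fold-translate (suc m) i = to-cong (begin
      x ∙ from (fold i translate m)        ≈⟨ ∙-congˡ (from-cong (fold-translate m i)) ⟩
      x ∙ from (to (x ↑ m ∙ from i))   ≈⟨ ∙-congˡ (strictlyInverseʳ _) ⟩
      x ∙ (x ↑ m ∙ from i)             ≈⟨ assoc _ _ _ ⟨
      (x ∙ x ↑ m) ∙ from i             ∎)
    translateᵖ : ∀ i → fold i translate p ≡ i
    translateᵖ i = ≡.trans (fold-translate p i)
      (≡.trans (to-cong (≈-trans (∙-congʳ xᵖ) (identityˡ _))) (strictlyInverseˡ i))
    moves : ∀ {i} → i ∈ˡ allFin n → translate i ≢ i
    moves {i} _ eq = x≉ε (identityˡ-unique x (from i)
      (≈-trans (≈-sym (strictlyInverseʳ _)) (from-cong eq)))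

-- p-elements and Sylow subgroups

prime[3] : Prime 3
prime[3] = toWitness {a? = prime? 3} tt

module FiniteEPPO {c ℓ} (G : Group c ℓ) {n} (card : HasCardinality (Group.setoid G) n) (eppo : EPPO G) where
  open Group G renaming (refl to ≈-refl; sym to ≈-sym; trans to ≈-trans)
  open Powers G
  open Finite G card
  open GroupProperties G
  open Inverse card using (to; from; to-cong; strictlyInverseˡ; strictlyInverseʳ)
  open import Relation.Binary.Reasoning.Setoid setoid

  -- No minimal exponent is demanded, so closure under conjugation and commuting products needs only
  -- power laws; the exact order is recovered from EPPO in `pElement-order`.
  PElement : ℕ → Carrier → Set ℓ
  PElement p x = ∃[ k ] x ↑ (p ^ k) ≈ ε

  pElement-resp : ∀ {p x y} → x ≈ y → PElement p x → PElement p y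
  pElement-resp {p} x≈y (k , eq) = k , ≈-trans (↑-congˡ (p ^ k) (≈-sym x≈y)) eq

  order⇒pElement : ∀ {p x} → ∃[ k ] HasOrder G x (p ^ k) → PElement p x
  order⇒pElement (k , _ , eq , _) = k , eq

  order-1⇒ε : ∀ {x} → HasOrder G x 1 → x ≈ ε
  order-1⇒ε (_ , eq , _) = ≈-trans (≈-sym (↑1 _)) eq

  pElement-order : ∀ {p x} → Prime p → PElement p x → ∃[ k ] HasOrder G x (p ^ k)
  pElement-order {p} {x} pp (k , eq) with eppo x
  ... | _ , zero  , _  , ord = zero , ord
  ... | q , suc j , qq , ord
    with refl ← prime∣prime⇒≡ qq pp (prime∣^⇒∣ qq p k (∣-trans (m∣m*n (q ^ j)) (order-∣ ord eq))) =
    suc j , ord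

  pElement-prime-unique : ∀ {p q x} → Prime p → Prime q → ¬ (x ≈ ε) →
                          PElement p x → PElement q x → p ≡ q
  pElement-prime-unique {q = q} pp qq x≉e px (k , eq) with pElement-order pp px
  ... | zero  , ord = contradiction (order-1⇒ε ord) x≉e
  ... | suc j , ord = prime∣prime⇒≡ pp qq (prime∣^⇒∣ pp q k (∣-trans (m∣m*n _) (order-∣ ord eq)))

  -- For a non-identity element only one prime is possible, and EPPO names it; comparing it with p
  -- replaces an unbounded search for the exponent.
  pElement? : ∀ {p} → Prime p → ∀ x → Dec (PElement p x)
  pElement? {p} pp x with x ≟ ε
  ... | yes x≈e = yes (0 , ≈-trans (↑1 x) x≈e)
  ... | no  x≉e with q , k , qq , ord ← eppo x =
    map′ (λ { refl → order⇒pElement (k , ord) })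
         (λ px → pElement-prime-unique pp qq x≉e px (order⇒pElement (k , ord)))
         (p ℕ.≟ q)

  pElement-⁻¹ : ∀ {p x} → PElement p x → PElement p (x ⁻¹)
  pElement-⁻¹ {p} {x} (k , eq) = k , ≈-trans (lem (p ^ k)) (≈-trans (⁻¹-cong eq) ε⁻¹≈ε)
    where
    lem : ∀ m → (x ⁻¹) ↑ m ≈ (x ↑ m) ⁻¹
    lem zero    = ≈-sym ε⁻¹≈ε
    lem (suc m) = begin
      x ⁻¹ ∙ (x ⁻¹) ↑ m          ≈⟨ ∙-congˡ (lem m) ⟩
      x ⁻¹ ∙ (x ↑ m) ⁻¹          ≈⟨ ⁻¹-anti-homo-∙ _ _ ⟨
      (x ↑ m ∙ x) ⁻¹             ≈⟨ ⁻¹-cong (∙-congˡ (↑1 x)) ⟨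
      (x ↑ m ∙ x ↑ 1) ⁻¹         ≈⟨ ⁻¹-cong (↑-+ x m 1) ⟨
      (x ↑ (m + 1)) ⁻¹           ≡⟨ cong (λ i → (x ↑ i) ⁻¹) (ℕ.+-comm m 1) ⟩
      (x ↑ (1 + m)) ⁻¹           ∎

  pElement-conj : ∀ {p} g {x} → PElement p x → PElement p ((g ∙ x) ∙ g ⁻¹)
  pElement-conj {p} g {x} (k , eq) = k , (begin
    ((g ∙ x) ∙ g ⁻¹) ↑ (p ^ k)   ≈⟨ lem (p ^ k) ⟩
    (g ∙ x ↑ (p ^ k)) ∙ g ⁻¹     ≈⟨ ∙-congʳ (≈-trans (∙-congˡ eq) (identityʳ g)) ⟩
    g ∙ g ⁻¹                     ≈⟨ inverseʳ g ⟩
    ε                            ∎)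
    where
    lem : ∀ m → ((g ∙ x) ∙ g ⁻¹) ↑ m ≈ (g ∙ x ↑ m) ∙ g ⁻¹
    lem zero    = ≈-sym (≈-trans (∙-congʳ (identityʳ g)) (inverseʳ g))
    lem (suc m) = begin
      ((g ∙ x) ∙ g ⁻¹) ∙ ((g ∙ x) ∙ g ⁻¹) ↑ m     ≈⟨ ∙-congˡ (lem m) ⟩
      ((g ∙ x) ∙ g ⁻¹) ∙ ((g ∙ x ↑ m) ∙ g ⁻¹)     ≈⟨ assoc _ _ _ ⟨
      (((g ∙ x) ∙ g ⁻¹) ∙ (g ∙ x ↑ m)) ∙ g ⁻¹     ≈⟨ ∙-congʳ (assoc _ _ _) ⟩
      ((g ∙ x) ∙ (g ⁻¹ ∙ (g ∙ x ↑ m))) ∙ g ⁻¹     ≈⟨ ∙-congʳ (∙-congˡ (\\-leftDividesʳ g _)) ⟩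
      ((g ∙ x) ∙ x ↑ m) ∙ g ⁻¹                    ≈⟨ ∙-congʳ (assoc _ _ _) ⟩
      (g ∙ (x ∙ x ↑ m)) ∙ g ⁻¹                    ∎

  pElement-∙-comm : ∀ {p x y} → x ∙ y ≈ y ∙ x → PElement p x → PElement p y → PElement p (x ∙ y)
  pElement-∙-comm {p} {x} {y} comm (k , xᵏ) (l , yˡ) = k + l , (begin
    (x ∙ y) ↑ (p ^ (k + l))                ≈⟨ distrib (p ^ (k + l)) ⟩
    x ↑ (p ^ (k + l)) ∙ y ↑ (p ^ (k + l))  ≈⟨ ∙-cong (↑-∣ (∣-^-mono p (ℕ.m≤m+n k l)) xᵏ) (↑-∣ (∣-^-mono p (ℕ.m≤n+m l k)) yˡ) ⟩
    ε ∙ ε                                  ≈⟨ identityˡ ε ⟩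
    ε                                      ∎)
    where
    commᵐ : ∀ m → y ∙ x ↑ m ≈ x ↑ m ∙ y
    commᵐ zero    = ≈-trans (identityʳ y) (≈-sym (identityˡ y))
    commᵐ (suc m) = begin
      y ∙ (x ∙ x ↑ m)  ≈⟨ assoc _ _ _ ⟨
      (y ∙ x) ∙ x ↑ m  ≈⟨ ∙-congʳ comm ⟨
      (x ∙ y) ∙ x ↑ m  ≈⟨ assoc _ _ _ ⟩
      x ∙ (y ∙ x ↑ m)  ≈⟨ ∙-congˡ (commᵐ m) ⟩
      x ∙ (x ↑ m ∙ y)  ≈⟨ assoc _ _ _ ⟨
      (x ∙ x ↑ m) ∙ y  ∎
    distrib : ∀ m → (x ∙ y) ↑ m ≈ x ↑ m ∙ y ↑ m
    distrib zero    = ≈-sym (identityˡ ε)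
    distrib (suc m) = begin
      (x ∙ y) ∙ (x ∙ y) ↑ m      ≈⟨ ∙-congˡ (distrib m) ⟩
      (x ∙ y) ∙ (x ↑ m ∙ y ↑ m)  ≈⟨ assoc _ _ _ ⟩
      x ∙ (y ∙ (x ↑ m ∙ y ↑ m))  ≈⟨ ∙-congˡ (assoc _ _ _) ⟨
      x ∙ ((y ∙ x ↑ m) ∙ y ↑ m)  ≈⟨ ∙-congˡ (∙-congʳ (commᵐ m)) ⟩
      x ∙ ((x ↑ m ∙ y) ∙ y ↑ m)  ≈⟨ ∙-congˡ (assoc _ _ _) ⟩
      x ∙ (x ↑ m ∙ (y ∙ y ↑ m))  ≈⟨ assoc _ _ _ ⟨
      (x ∙ x ↑ m) ∙ (y ∙ y ↑ m)  ∎

  -- Finding three different non-identity p-elements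

  ◂-injective : ∀ {k x} {v : Fin k → Carrier} → (∀ i → ¬ (x ≈ v i)) →
                Injective _≡_ _≈_ v → Injective _≡_ _≈_ (x ◂ v)
  ◂-injective x≉v inj {zero}  {zero}  eq = refl
  ◂-injective x≉v inj {zero}  {suc j} eq = contradiction eq (x≉v j)
  ◂-injective x≉v inj {suc i} {zero}  eq = contradiction (≈-sym eq) (x≉v i)
  ◂-injective x≉v inj {suc i} {suc j} eq = cong suc (inj eq)

  -- Stated with the identity in front, as the same four elements are needed
  -- for counting the elements of a subgroup.
  ThreePElements : ℕ → Set _
  ThreePElements p = Σ (Fin 3 → Carrier) λ v → Injective _≡_ _≈_ (ε ◂ v) × (∀ i → PElement p (v i))

  threePElements : ∀ {p a b c} → ¬ (a ≈ ε) → ¬ (b ≈ ε) → ¬ (c ≈ ε) →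
                   ¬ (a ≈ b) → ¬ (a ≈ c) → ¬ (b ≈ c) →
                   PElement p a → PElement p b → PElement p c → ThreePElements p
  threePElements {a = a} {b} {c} a≉e b≉e c≉e a≉b a≉c b≉c pa pb pc =
    (a ◂ b ◂ c ◂ ⟨⟩) ,
    ◂-injective {3} (λ { zero → a≉e ∘ ≈-sym ; (suc zero) → b≉e ∘ ≈-sym ; (suc (suc zero)) → c≉e ∘ ≈-sym })
      (◂-injective {2} (λ { zero → a≉b ; (suc zero) → a≉c })
        (◂-injective {1} (λ { zero → b≉c }) (◂-injective {0} (λ ()) λ { {()} }))) ,
    λ { zero → pa ; (suc zero) → pb ; (suc (suc zero)) → pc }

  -- The third element is the conjugate of b by a if that differs from b. Otherwise a and b commute
  -- and their product serves, unless it is ε. In that last case b is the inverse of a and the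
  -- square of a serves: it is not ε since a and b differ, and not b since a would then also be a
  -- 3-element.
  three-2-elements : ∀ {a b} → ¬ (a ≈ ε) → ¬ (b ≈ ε) → ¬ (a ≈ b) →
                     PElement 2 a → PElement 2 b → ThreePElements 2
  three-2-elements {a} {b} a≉e b≉e a≉b 2a 2b with (a ∙ b) ∙ a ⁻¹ ≟ b
  ... | no conj≉b = threePElements a≉e b≉e
    (λ eq → b≉e (conj-cancel (≈-trans eq (≈-sym (≈-trans (∙-congʳ (identityʳ a)) (inverseʳ a))))))
    a≉b
    (λ eq → a≉b (≈-sym (conj-cancel (≈-trans (≈-sym eq) (≈-sym (//-rightDividesʳ a a))))))
    (conj≉b ∘ ≈-sym) 2a 2b (pElement-conj a 2b)
    where
    conj-cancel : ∀ {x y} → (a ∙ x) ∙ a ⁻¹ ≈ (a ∙ y) ∙ a ⁻¹ → x ≈ y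
    conj-cancel eq = ∙-cancelˡ a _ _ (∙-cancelʳ (a ⁻¹) _ _ eq)
  ... | yes conj≈b with a ∙ b ≟ ε
  ...   | no ab≉e = threePElements a≉e b≉e ab≉e a≉b
    (λ eq → b≉e (identityʳ-unique a b (≈-sym eq)))
    (λ eq → a≉e (identityˡ-unique a b (≈-sym eq)))
    2a 2b (pElement-∙-comm ab≈ba 2a 2b)
    where
    ab≈ba : a ∙ b ≈ b ∙ a
    ab≈ba = ≈-trans (≈-sym (//-rightDividesˡ a (a ∙ b))) (∙-congʳ conj≈b)
  ...   | yes ab≈e = threePElements a≉e b≉e aa≉e a≉b
    (λ eq → a≉e (identityˡ-unique a a (≈-sym eq)))
    (λ b≈aa → contradiction
      (pElement-prime-unique prime[2] prime[3] a≉e 2a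
        (1 , ≈-trans (∙-congˡ (∙-congˡ (↑1 a))) (≈-trans (∙-congˡ (≈-sym b≈aa)) ab≈e)))
      (λ ()))
    2a 2b (pElement-∙-comm ≈-refl 2a 2a)
    where
    aa≉e : ¬ (a ∙ a ≈ ε)
    aa≉e eq = a≉b (∙-cancelˡ a _ _ (≈-trans eq (≈-sym ab≈e)))

  -- An element equal to its inverse has square ε, so it would be a 2-element as well as a
  -- p-element.
  ≉⁻¹ : ∀ {p x} → Prime p → p ≢ 2 → ¬ (x ≈ ε) → PElement p x → ¬ (x ≈ x ⁻¹)
  ≉⁻¹ {p} {x} pp p≢2 x≉e px x≈x⁻¹ = p≢2 (pElement-prime-unique pp prime[2] x≉e px
    (1 , ≈-trans (∙-congˡ (↑1 x)) (≈-trans (∙-congˡ x≈x⁻¹) (inverseʳ x))))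

  ⁻¹≉ε : ∀ {x} → ¬ (x ≈ ε) → ¬ (x ⁻¹ ≈ ε)
  ⁻¹≉ε x≉e eq = x≉e (⁻¹-injective (≈-trans eq (≈-sym ε⁻¹≈ε)))

  three-3-elements : ∀ {a b} → ¬ (a ≈ ε) → ¬ (b ≈ ε) → ¬ (b ≈ a) → ¬ (b ≈ a ⁻¹) →
                     PElement 3 a → PElement 3 b → ThreePElements 3
  three-3-elements {a} {b} a≉e b≉e b≉a b≉a⁻¹ 3a 3b =
    threePElements b≉e a≉e (⁻¹≉ε a≉e) b≉a b≉a⁻¹ (≉⁻¹ prime[3] (λ ()) a≉e 3a) 3b 3a (pElement-⁻¹ 3a)

  -- For z of order p from Cauchy's theorem, the elements z, z², z³ serve. Together with ε = z⁰ they
  -- have the exponents 0 to 3, all below p, and such powers of z are distinct.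
  three-p-elements : ∀ {p} → Prime p → p ≥ 5 → p ∣ n → ThreePElements p
  three-p-elements {p} pp p≥5 p∣n with z , z≉e , zᵖ ← cauchy pp p∣n =
    (λ i → z ↑ suc (toℕ i)) , injective ,
    λ i → 1 , ≈-trans (≈-sym (↑-* z (p ^ 1) (suc (toℕ i)))) (↑-∣ {z} {p} (∣m⇒∣m*n _ (m∣m*n 1)) zᵖ)
    where
    ↑-distinct : ∀ {i j} → i < j → j < p → ¬ (z ↑ i ≈ z ↑ j)
    ↑-distinct {i} {j} i<j j<p eq = z≉e (↑-coprime (prime⇒coprime pp j∸i<p) zᵖ
      (identityʳ-unique (z ↑ i) _ (begin
        z ↑ i ∙ z ↑ (j ∸ i)   ≈⟨ ↑-+ z i (j ∸ i) ⟨
        z ↑ (i + (j ∸ i))     ≡⟨ cong (z ↑_) (ℕ.m+[n∸m]≡n (ℕ.<⇒≤ i<j)) ⟩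
        z ↑ j                 ≈⟨ eq ⟨
        z ↑ i                 ∎)))
      where
      instance
        j∸i≢0 : NonZero (j ∸ i)
        j∸i≢0 = >-nonZero (ℕ.m<n⇒0<n∸m i<j)
      j∸i<p : j ∸ i < p
      j∸i<p = ℕ.≤-<-trans (ℕ.m∸n≤m j i) j<p

    toℕ<p : ∀ (i : Fin 4) → toℕ i < p
    toℕ<p i = ℕ.<-trans (Fin.toℕ<n i) p≥5

    ◂-powers : ∀ (i : Fin 4) → (ε ◂ λ j → z ↑ suc (toℕ j)) i ≡ z ↑ toℕ i
    ◂-powers zero    = refl
    ◂-powers (suc i) = refl

    injective : Injective {A = Fin 4} _≡_ _≈_ (ε ◂ λ i → z ↑ suc (toℕ i))
    injective {i} {j} eq rewrite ◂-powers i | ◂-powers j with ℕ.<-cmp (toℕ i) (toℕ j)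
    ... | tri< i<j _ _ = contradiction eq (↑-distinct i<j (toℕ<p j))
    ... | tri≈ _ i≡j _ = Fin.toℕ-injective i≡j
    ... | tri> _ _ j<i = contradiction (≈-sym eq) (↑-distinct j<i (toℕ<p i))

  -- A non-identity p-element has some order p ^ (k + 1). Its p ^ k-th power is not ε by minimality
  -- of the order, but its p-th power is, so translation by it applies.
  threePElements⇒∣ : ∀ {p} → Prime p → ThreePElements p → p ∣ n
  threePElements⇒∣ {p} pp (v , inj , pv) with pElement-order pp (pv zero)
  ... | zero  , ord = contradiction (inj {suc zero} {zero} (order-1⇒ε ord)) λ ()
  ... | suc k , (_ , vᵖ , least) = translation-order∣card pp {v zero ↑ (p ^ k)}
    (λ eq → ℕ.<⇒≱ (ℕ.^-monoʳ-< p (nonTrivial⇒n>1 p {{prime⇒nonTrivial pp}}) (ℕ.n<1+n k))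
                   (least (p ^ k) (ℕ.m^n>0 p {{prime⇒nonZero pp}} k) eq))
    (≈-trans (≈-sym (↑-* (v zero) p (p ^ k))) vᵖ)

  -- Decidable subsets and normal p-subgroups

  ∈-resp : ∀ (P : Subset setoid) {x y} → x ≈ y → x ∈ P → y ∈ P
  ∈-resp P x≈y = subst T (Func.cong P x≈y)

  all? : ∀ {a} {P : Carrier → Set a} → (∀ {x y} → x ≈ y → P x → P y) →
         (∀ x → Dec (P x)) → Dec (∀ x → P x)
  all? resp P? = map′ (λ p x → resp (strictlyInverseʳ x) (p (to x))) (λ p i → p (from i))
                      (Fin.all? (P? ∘ from))

  module Comprehension {a} {P : Carrier → Set a} (P? : ∀ x → Dec (P x))
                       (resp : ∀ {x y} → x ≈ y → P x → P y) where

    comprehension : Subset setoid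
    comprehension = record
      { to   = λ x → ⌊ P? x ⌋
      ; cong = λ {x} {y} x≈y → ≡.trans (isYes≗does (P? x))
          (≡.trans (does-⇔ (mk⇔ (resp x≈y) (resp (≈-sym x≈y))) (P? x) (P? y))
                   (≡.sym (isYes≗does (P? y))))
      }

    ∈⁺ : ∀ {x} → P x → x ∈ comprehension
    ∈⁺ = fromWitness

    ∈⁻ : ∀ {x} → x ∈ comprehension → P x
    ∈⁻ = toWitness

  open Comprehension (_≟ ε) (λ x≈y x≈e → ≈-trans (≈-sym x≈y) x≈e) public
    using () renaming (comprehension to ⟨ε⟩; ∈⁺ to ∈⟨ε⟩⁺; ∈⁻ to ∈⟨ε⟩⁻)

  -- Inverses come for free, being powers.
  submonoid⇒subgroup : ∀ {P : Subset setoid} → ε ∈ P → (∀ {x y} → x ∈ P → y ∈ P → x ∙ y ∈ P) →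
                       IsSubgroup G P
  submonoid⇒subgroup {P} e∈ ∙∈ = record { ε∈ = e∈ ; ∙∈ = ∙∈ ; ⁻¹∈ = ⁻¹∈ }
    where
    ↑∈ : ∀ {x} m → x ∈ P → x ↑ m ∈ P
    ↑∈ zero    x∈ = e∈
    ↑∈ (suc m) x∈ = ∙∈ x∈ (↑∈ m x∈)
    ⁻¹∈ : ∀ {x} → x ∈ P → x ⁻¹ ∈ P
    ⁻¹∈ {x} x∈ with q , k , qq , o>0 , eq , _ ← eppo x =
      ∈-resp P (inverseʳ-unique x _ (subst (λ m → x ↑ m ≈ ε) (≡.sym (ℕ.m+[n∸m]≡n o>0)) eq))
        (↑∈ (q ^ k ∸ 1) x∈)

  pElements⇒isPSubgroup : ∀ {p P} → Prime p → IsSubgroup G P →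
                          (∀ {x} → x ∈ P → PElement p x) → IsPSubgroup G p P
  pElements⇒isPSubgroup pp sub pP = sub , λ x∈ → pElement-order pp (pP x∈)

  module _ {P : Subset setoid} (sub : IsSubgroup G P) (normal : IsNormal G P) where
    open IsSubgroup sub

    -- The element factors as the conjugate of u by h times `h ∙ z`, and normality puts the first
    -- factor into P.
    normal-insert : ∀ {h u z} → u ∈ P → h ∙ z ∈ P → (h ∙ u) ∙ z ∈ P
    normal-insert {h} {u} {z} u∈ hz∈ = ∈-resp P (begin
      ((h ∙ u) ∙ h ⁻¹) ∙ (h ∙ z)  ≈⟨ assoc _ _ _ ⟩
      (h ∙ u) ∙ (h ⁻¹ ∙ (h ∙ z))  ≈⟨ ∙-congˡ (\\-leftDividesʳ h z) ⟩
      (h ∙ u) ∙ z                 ∎) (∙∈ (normal h u∈) hz∈)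

    -- The hypothesis says that h and z are mutually inverse modulo P, and so are their powers. The
    -- calculation stays in G: the element for m is inserted between one more h and one more z.
    normal-↑ : ∀ {h z} m → h ∙ z ∈ P → h ↑ m ∙ z ↑ m ∈ P
    normal-↑ zero    hz∈ = ∈-resp P (≈-sym (identityˡ ε)) ε∈
    normal-↑ {h} {z} (suc m) hz∈ = ∈-resp P (begin
      (h ∙ (h ↑ m ∙ z ↑ m)) ∙ z   ≈⟨ ∙-congʳ (assoc _ _ _) ⟨
      ((h ∙ h ↑ m) ∙ z ↑ m) ∙ z   ≈⟨ assoc _ _ _ ⟩
      (h ∙ h ↑ m) ∙ (z ↑ m ∙ z)   ≈⟨ ∙-congˡ (∙-congˡ (↑1 z)) ⟨
      (h ∙ h ↑ m) ∙ (z ↑ m ∙ z ↑ 1) ≈⟨ ∙-congˡ (↑-+ z m 1) ⟨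
      (h ∙ h ↑ m) ∙ z ↑ (m + 1)   ≡⟨ cong (λ i → (h ∙ h ↑ m) ∙ z ↑ i) (ℕ.+-comm m 1) ⟩
      h ↑ suc m ∙ z ↑ suc m       ∎) (normal-insert (normal-↑ m hz∈) hz∈)

  -- P⟨y⟩ is a p-subgroup containing P.
  normal-sylow-∋ : ∀ {p P y} → Prime p → IsSylow G p P → IsNormal G P → PElement p y → y ∈ P
  normal-sylow-∋ {p} {P} {y} pp ((sub , pP) , maximal) normal (k , yᵐ) =
    maximal P⟨y⟩ (pElements⇒isPSubgroup pp (submonoid⇒subgroup e∈ closed) pElt) P⊆ y
      -- The exponent m - 1 shows that y lies in `P⟨y⟩`: multiplying y by that power gives y ^ m,
      -- which is ε.
      (∈⁺ (m ∸ 1 , ∈-resp P (≈-sym (≈-trans (reflexive (cong (y ↑_) (ℕ.m+[n∸m]≡n m>0))) yᵐ)) ε∈))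
    where
    open IsSubgroup sub
    m = p ^ k
    m>0 : 0 < m
    m>0 = ℕ.m^n>0 p {{prime⇒nonZero pp}} k
    instance
      m≢0 : NonZero m
      m≢0 = >-nonZero m>0

    -- Membership in P⟨y⟩ without negative exponents: h is moved into P by multiplying it with a
    -- power of y. Only the exponent modulo m matters, so deciding it is a finite search.
    Coset : Carrier → Set
    Coset h = ∃[ i ] h ∙ y ↑ i ∈ P

    coset? : ∀ h → Dec (Coset h)
    coset? h = map′ (λ (i , ∈P) → toℕ i , ∈P)
      (λ (i , ∈P) → fromℕ< (m%n<n i m) , ∈-resp P (∙-congˡ (≈-trans (↑-% m i yᵐ)
        (reflexive (cong (y ↑_) (≡.sym (Fin.toℕ-fromℕ< (m%n<n i m))))))) ∈P)
      (Fin.any? λ i → T? (Func.to P (h ∙ y ↑ toℕ i)))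

    open Comprehension coset? (λ x≈y (i , ∈P) → i , ∈-resp P (∙-congʳ x≈y) ∈P)
      renaming (comprehension to P⟨y⟩)

    P⊆ : P ⊆ P⟨y⟩
    P⊆ x x∈ = ∈⁺ (0 , ∈-resp P (≈-sym (identityʳ x)) x∈)

    e∈ : ε ∈ P⟨y⟩
    e∈ = P⊆ ε ε∈

    closed : ∀ {g h} → g ∈ P⟨y⟩ → h ∈ P⟨y⟩ → g ∙ h ∈ P⟨y⟩
    closed {g} {h} g∈ h∈ with i , gyⁱ ← ∈⁻ g∈ | j , hyʲ ← ∈⁻ h∈ =
      ∈⁺ (j + i , ∈-resp P (begin
        (g ∙ (h ∙ y ↑ j)) ∙ y ↑ i   ≈⟨ ∙-congʳ (assoc _ _ _) ⟨
        ((g ∙ h) ∙ y ↑ j) ∙ y ↑ i   ≈⟨ assoc _ _ _ ⟩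
        (g ∙ h) ∙ (y ↑ j ∙ y ↑ i)   ≈⟨ ∙-congˡ (↑-+ y j i) ⟨
        (g ∙ h) ∙ y ↑ (j + i)       ∎) (normal-insert sub normal hyʲ gyⁱ))

    -- The m-th power removes the contribution of y, so h ^ m lies in P and some p ^ l-th power of
    -- it is ε; hence the exponent l + k for h.
    pElt : ∀ {h} → h ∈ P⟨y⟩ → PElement p h
    pElt {h} h∈ with i , hyⁱ ← ∈⁻ h∈
      with l , _ , eq , _ ← pP (∈-resp P (begin
        h ↑ m ∙ (y ↑ i) ↑ m    ≈⟨ ∙-congˡ (↑-* y m i) ⟨
        h ↑ m ∙ y ↑ (m * i)    ≈⟨ ∙-congˡ (↑-∣ {y} {m} (m∣m*n i) yᵐ) ⟩
        h ↑ m ∙ ε              ≈⟨ identityʳ _ ⟩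
        h ↑ m                  ∎) (normal-↑ sub normal m hyⁱ)) =
      l + k , (begin
        h ↑ (p ^ (l + k))      ≡⟨ cong (h ↑_) (ℕ.^-distribˡ-+-* p l k) ⟩
        h ↑ (p ^ l * p ^ k)    ≈⟨ ↑-* h (p ^ l) (p ^ k) ⟩
        (h ↑ m) ↑ (p ^ l)      ≈⟨ eq ⟩
        ε                      ∎)

  -- Sylow subgroups

  isNormal? : ∀ P → Dec (IsNormal G P)
  isNormal? P = map′ (λ normal g {x} → normal g x) (λ normal g x → normal g)
    (all? (λ g≈h norm x x∈ → ∈-resp P (∙-cong (∙-congʳ g≈h) (⁻¹-cong g≈h)) (norm x x∈)) λ g →
      all? (λ x≈y norm y∈ → ∈-resp P (∙-congʳ (∙-congˡ x≈y)) (norm (∈-resp P (≈-sym x≈y) y∈))) λ x →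
        T? _ →-dec T? _)

  isSubgroup? : ∀ P → Dec (IsSubgroup G P)
  isSubgroup? P = map′ (λ (e∈ , ∙∈) → submonoid⇒subgroup e∈ λ {x} {y} → ∙∈ x y)
                       (λ sub → IsSubgroup.ε∈ sub , λ x y → IsSubgroup.∙∈ sub)
    (T? _ ×-dec
      (all? (λ x≈ ∙∈ y x∈ y∈ → ∈-resp P (∙-congʳ x≈) (∙∈ y (∈-resp P (≈-sym x≈) x∈) y∈)) λ x →
        all? (λ y≈ ∙∈ x∈ y∈ → ∈-resp P (∙-congˡ y≈) (∙∈ x∈ (∈-resp P (≈-sym y≈) y∈))) λ y →
          T? _ →-dec (T? _ →-dec T? _)))

  isPSubgroup? : ∀ {p} → Prime p → ∀ P → Dec (IsPSubgroup G p P)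
  isPSubgroup? {p} pp P = map′ (λ (sub , pP) → pElements⇒isPSubgroup pp sub λ {x} → pP x)
                               (λ (sub , pP) → sub , λ x x∈ → order⇒pElement (pP x∈))
    (isSubgroup? P ×-dec
      all? (λ x≈y pel y∈ → pElement-resp x≈y (pel (∈-resp P (≈-sym x≈y) y∈)))
           (λ x → T? _ →-dec pElement? pp x))

  isPSubgroup-resp : ∀ {p P Q} → P ⊆ Q → Q ⊆ P → IsPSubgroup G p P → IsPSubgroup G p Q
  isPSubgroup-resp P⊆Q Q⊆P (sub , pP) =
    submonoid⇒subgroup (P⊆Q _ ε∈) (λ x∈ y∈ → P⊆Q _ (∙∈ (Q⊆P _ x∈) (Q⊆P _ y∈))) ,
    λ x∈ → pP (Q⊆P _ x∈)
    where open IsSubgroup sub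

  -- Bit vectors over `Fin n` can be searched exhaustively, and strict inclusion between them is
  -- well-founded; characteristic functions on the carrier are translated into them for this
  -- purpose.
  decode : FinSubset.Subset n → Subset setoid
  decode S = record { to = λ x → lookup S (to x) ; cong = λ x≈y → cong (lookup S) (to-cong x≈y) }

  encode : Subset setoid → FinSubset.Subset n
  encode P = tabulate (λ i → Func.to P (from i))

  decode-encode : ∀ P x → Func.to (decode (encode P)) x ≡ Func.to P x
  decode-encode P x = ≡.trans (lookup∘tabulate _ (to x)) (Func.cong P (strictlyInverseʳ x))

  -- Starting from the trivial subgroup, a strictly larger p-subgroup is taken as long as there is
  -- one. When the search fails, a p-subgroup containing the current one cannot have an element
  -- outside it.
  sylow-exists : ∀ {p} → Prime p → ∃[ P ] IsSylow G p P
  sylow-exists {p} pp = extend (encode ⟨ε⟩) (⊃-wellFounded _) (encode-isP ⟨ε⟩ ⟨ε⟩-isP)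
    where
    encode-isP : ∀ P → IsPSubgroup G p P → IsPSubgroup G p (decode (encode P))
    encode-isP P = isPSubgroup-resp {p} {P} {decode (encode P)}
      (λ x → subst T (≡.sym (decode-encode P x))) (λ x → subst T (decode-encode P x))

    ⟨ε⟩-isP : IsPSubgroup G p ⟨ε⟩
    ⟨ε⟩-isP = pElements⇒isPSubgroup pp
      (submonoid⇒subgroup (∈⟨ε⟩⁺ ≈-refl) (λ x∈ y∈ → ∈⟨ε⟩⁺ (≈-trans (∙-cong (∈⟨ε⟩⁻ x∈) (∈⟨ε⟩⁻ y∈)) (identityˡ ε))))
      (λ x∈ → 0 , ≈-trans (↑1 _) (∈⟨ε⟩⁻ x∈))

    extend : ∀ S → Acc _⊃_ S → IsPSubgroup G p (decode S) → ∃[ P ] IsSylow G p P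
    extend S (acc rec) isP
      with anySubset? (λ S′ → (S ⊂? S′) ×-dec isPSubgroup? pp (decode S′))
    ... | yes (S′ , S⊂S′ , isP′) = extend S′ (rec S⊂S′) isP′
    ... | no none = decode S , isP , λ Q isQ S⊆Q x x∈Q → decidable-stable (T? _) λ x∉S →
      none (encode Q , (sub Q S⊆Q , to x , lookup⇒[]= _ _ (true⁺ (subst T (≡.sym (decode-encode Q x)) x∈Q)) ,
                        λ ∈S → x∉S (true⁻ ([]=⇒lookup ∈S))) ,
            encode-isP Q isQ)
      where
      true⁺ : ∀ {b} → T b → b ≡ true
      true⁺ = Equivalence.to T-≡
      true⁻ : ∀ {b} → b ≡ true → T b
      true⁻ = Equivalence.from T-≡
      sub : ∀ Q → decode S ⊆ Q → S FinSubset.⊆ encode Q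
      sub Q S⊆Q {i} i∈S = lookup⇒[]= i _ (≡.trans (lookup∘tabulate _ i) (true⁺
        (S⊆Q (from i) (true⁻ (≡.trans (cong (lookup S) (strictlyInverseˡ i)) ([]=⇒lookup i∈S))))))

  -- A trivial P would be normal and hence contain all p-elements, among them the non-identity one
  -- from Cauchy's theorem.
  sylow-nontrivial : ∀ {p P} → Prime p → p ∣ n → IsSylow G p P → ∃[ x ] x ∈ P × ¬ (x ≈ ε)
  sylow-nontrivial {p} {P} pp p∣n syl@((sub , _) , _)
    with search (λ x≈y (x∈ , x≉e) → ∈-resp P x≈y x∈ , λ y≈e → x≉e (≈-trans x≈y y≈e))
                (λ x → T? (Func.to P x) ×-dec ¬? (x ≟ ε))
  ... | yes found = found
  ... | no none with z , z≉e , zᵖ ← cauchy pp p∣n =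
    z , normal-sylow-∋ pp syl normal (1 , ↑-∣ {z} {p} (m∣m*n 1) zᵖ) , z≉e
    where
    trivial : ∀ {x} → x ∈ P → x ≈ ε
    trivial {x} x∈ = decidable-stable (x ≟ ε) λ x≉e → none (x , x∈ , x≉e)
    normal : IsNormal G P
    normal g x∈ = ∈-resp P
      (≈-sym (≈-trans (∙-congʳ (≈-trans (∙-congˡ (trivial x∈)) (identityʳ g))) (inverseʳ g)))
      (IsSubgroup.ε∈ sub)

  -- If `v` missed nothing of P, it would be a bijection from `Fin k` onto P.
  another : ∀ {k} (P : Subset setoid) (v : Fin k → Carrier) → Injective _≡_ _≈_ v → (∀ i → v i ∈ P) →
            ¬ HasCardinality ⟦ P ⟧ k → ∃[ x ] x ∈ P × (∀ i → ¬ (x ≈ v i))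
  another P v inj v∈ ¬card
    with search (λ x≈y (x∈ , x≉) → ∈-resp P x≈y x∈ , λ i y≈ → x≉ i (≈-trans x≈y y≈))
                (λ x → T? (Func.to P x) ×-dec Fin.all? (λ i → ¬? (x ≟ v i)))
  ... | yes found = found
  ... | no none = contradiction (record
    { to        = proj₁ ∘ index
    ; from      = λ i → v i , v∈ i
    ; to-cong   = λ {x} {y} x≈y → inj (≈-trans (≈-sym (proj₂ (index x))) (≈-trans x≈y (proj₂ (index y))))
    ; from-cong = λ { refl → ≈-refl }
    ; inverse   = (λ {i} {x} x≈vi → inj (≈-trans (≈-sym (proj₂ (index x))) x≈vi))
                , (λ { {x} refl → ≈-sym (proj₂ (index x)) })
    }) ¬card
    where
    index : (x : Σ Carrier (_∈ P)) → ∃[ i ] proj₁ x ≈ v i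
    index (x , x∈) = decidable-stable (Fin.any? (λ i → x ≟ v i))
      λ ¬∃ → none (x , x∈ , λ i x≈ → ¬∃ (i , x≈))

  not-normal : ∀ P → ¬ IsNormal G P → ∃[ g ] ∃[ x ] x ∈ P × (g ∙ x) ∙ g ⁻¹ ∉ P
  not-normal P ¬normal with search
    (λ g≈h (x , x∈ , x∉) → x , x∈ , λ ∈P → x∉ (∈-resp P (≈-sym (∙-cong (∙-congʳ g≈h) (⁻¹-cong g≈h))) ∈P))
    (λ g → search (λ x≈y (x∈ , x∉) → ∈-resp P x≈y x∈ , λ ∈P → x∉ (∈-resp P (≈-sym (∙-congʳ (∙-congˡ x≈y))) ∈P))
      (λ x → T? (Func.to P x) ×-dec ¬? (T? (Func.to P ((g ∙ x) ∙ g ⁻¹)))))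
  ... | yes found = found
  ... | no none = contradiction
    (λ g {x} x∈ → decidable-stable (T? _) λ x∉ → none (g , x , x∈ , x∉)) ¬normal

  -- Conditions (ii) and (iii) in terms of three p-elements

  SylowCondition : ℕ → Set _
  SylowCondition p = p ∣ n × ∃[ P ] IsSylow G p P × (¬ HasCardinality ⟦ P ⟧ p ⊎ ¬ IsNormal G P)

  -- If the Sylow subgroup is normal, it contains the three p-elements and ε. By the pigeonhole
  -- principle these four do not fit into a set of p < 4 elements.
  threePElements⇒sylowCondition : ∀ {p} → Prime p → p < 4 → ThreePElements p → SylowCondition p
  threePElements⇒sylowCondition {p} pp p<4 three@(v , inj , pv) with P , syl@((sub , _) , _) ← sylow-exists pp =
    threePElements⇒∣ pp three , P , syl , condition
    where
    module _ (normal : IsNormal G P) where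
      v∈ : ∀ i → (ε ◂ v) i ∈ P
      v∈ zero    = IsSubgroup.ε∈ sub
      v∈ (suc i) = normal-sylow-∋ pp syl normal (pv i)
      ¬card : ¬ HasCardinality ⟦ P ⟧ p
      ¬card card-P with i , j , i<j , eq ← Fin.pigeonhole p<4 (λ i → Inverse.to card-P ((ε ◂ v) i , v∈ i)) =
        contradiction (inj (≈-trans (≈-sym (Inverse.strictlyInverseʳ card-P ((ε ◂ v) i , v∈ i)))
          (≈-trans (Inverse.from-cong card-P eq) (Inverse.strictlyInverseʳ card-P ((ε ◂ v) j , v∈ j)))))
          (Fin.<⇒≢ i<j)
    condition : ¬ HasCardinality ⟦ P ⟧ p ⊎ ¬ IsNormal G P
    condition with isNormal? P
    ... | yes normal  = inj₁ (¬card normal)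
    ... | no  ¬normal = inj₂ ¬normal

  module _ {p P} (pp : Prime p) (isP : IsPSubgroup G p P) where
    open IsSubgroup (proj₁ isP)

    ∈⇒pElement : ∀ {x} → x ∈ P → PElement p x
    ∈⇒pElement x∈ = order⇒pElement (proj₂ isP x∈)

    conj∉⇒≉ : ∀ {g x y} → (g ∙ x) ∙ g ⁻¹ ∉ P → y ∈ P → ¬ ((g ∙ x) ∙ g ⁻¹ ≈ y)
    conj∉⇒≉ x∉ y∈ eq = x∉ (∈-resp P (≈-sym eq) y∈)

    conj∉⇒≉ε : ∀ {g x} → (g ∙ x) ∙ g ⁻¹ ∉ P → ¬ (x ≈ ε)
    conj∉⇒≉ε {g} x∉ x≈e = x∉ (∈-resp P
      (≈-sym (≈-trans (∙-congʳ (≈-trans (∙-congˡ x≈e) (identityʳ g))) (inverseʳ g))) ε∈)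

  -- If P does not have order 3, it contains some b besides ε, a and the inverse of a. If P is not
  -- normal, a conjugate of some x in P leaves P and so differs from ε, x and the inverse of x.
  sylowCondition-3⇒ : SylowCondition 3 → ThreePElements 3
  sylowCondition-3⇒ (3∣n , P , syl@(isP@(sub , _) , _) , inj₁ ¬card)
    with a , a∈ , a≉e ← sylow-nontrivial prime[3] 3∣n syl
    with b , b∈ , b≉ ← another P (ε ◂ a ◂ a ⁻¹ ◂ ⟨⟩)
           (◂-injective {2} (λ { zero → a≉e ∘ ≈-sym ; (suc zero) → ⁻¹≉ε a≉e ∘ ≈-sym })
             (◂-injective {1} (λ { zero → ≉⁻¹ prime[3] (λ ()) a≉e (∈⇒pElement prime[3] isP a∈) })
               (◂-injective {0} (λ ()) λ { {()} })))
           (λ { zero → IsSubgroup.ε∈ sub ; (suc zero) → a∈ ; (suc (suc zero)) → IsSubgroup.⁻¹∈ sub a∈ })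
           ¬card =
    three-3-elements a≉e (b≉ zero) (b≉ (suc zero)) (b≉ (suc (suc zero)))
      (∈⇒pElement prime[3] isP a∈) (∈⇒pElement prime[3] isP b∈)
  sylowCondition-3⇒ (3∣n , P , (isP@(sub , _) , _) , inj₂ ¬normal)
    with g , x , x∈ , x∉ ← not-normal P ¬normal =
    three-3-elements (conj∉⇒≉ε prime[3] isP x∉) (conj∉⇒≉ prime[3] isP x∉ (IsSubgroup.ε∈ sub))
      (conj∉⇒≉ prime[3] isP x∉ x∈) (conj∉⇒≉ prime[3] isP x∉ (IsSubgroup.⁻¹∈ sub x∈))
      (∈⇒pElement prime[3] isP x∈) (pElement-conj g (∈⇒pElement prime[3] isP x∈))

  -- The alternatives for the prime 3 recur, but they yield only two non-identity 2-elements, which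
  -- `three-2-elements` completes.
  sylowCondition-2⇒ : SylowCondition 2 → ThreePElements 2
  sylowCondition-2⇒ (2∣n , P , syl@(isP@(sub , _) , _) , inj₁ ¬card)
    with a , a∈ , a≉e ← sylow-nontrivial prime[2] 2∣n syl
    with b , b∈ , b≉ ← another P (ε ◂ a ◂ ⟨⟩)
           (◂-injective {1} (λ { zero → a≉e ∘ ≈-sym }) (◂-injective {0} (λ ()) λ { {()} }))
           (λ { zero → IsSubgroup.ε∈ sub ; (suc zero) → a∈ })
           ¬card =
    three-2-elements a≉e (b≉ zero) (b≉ (suc zero) ∘ ≈-sym)
      (∈⇒pElement prime[2] isP a∈) (∈⇒pElement prime[2] isP b∈)
  sylowCondition-2⇒ (2∣n , P , (isP@(sub , _) , _) , inj₂ ¬normal)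
    with g , x , x∈ , x∉ ← not-normal P ¬normal =
    three-2-elements (conj∉⇒≉ε prime[2] isP x∉) (conj∉⇒≉ prime[2] isP x∉ (IsSubgroup.ε∈ sub))
      (conj∉⇒≉ prime[2] isP x∉ x∈ ∘ ≈-sym)
      (∈⇒pElement prime[2] isP x∈) (pElement-conj g (∈⇒pElement prime[2] isP x∈))

  -- Separation of the order supergraph

  same-prime⇒adjacent : ∀ {p x y} → Prime p → PElement p x → PElement p y → ¬ (x ≈ y) → Adjacent G x y
  same-prime⇒adjacent {p} pp px py x≉y
    with i , ordx ← pElement-order pp px | j , ordy ← pElement-order pp py =
    x≉y , Sum.map (λ i≤j → -, -, ordx , ordy , ∣-^-mono p i≤j)
                  (λ j≤i → -, -, ordy , ordx , ∣-^-mono p j≤i) (ℕ.≤-total i j)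

  -- EPPO separates the primes here. If the order of y divides that of x, then y inherits the
  -- exponent of x. In the other direction y has some prime q, x is then a q-element too, and x
  -- being different from ε forces q = p.
  adjacent⇒same-prime : ∀ {p x y} → Prime p → ¬ (x ≈ ε) → Adjacent G x y → PElement p x → PElement p y
  adjacent⇒same-prime {p} {x} {y} pp x≉e (_ , inj₂ (m , k , (_ , yᵐ , _) , ordx , m∣k)) (l , xˡ) =
    l , ↑-∣ (∣-trans m∣k (order-∣ {n = p ^ l} ordx xˡ)) yᵐ
  adjacent⇒same-prime {p} {x} {y} pp x≉e (_ , inj₁ (m , k , (_ , xᵐ , _) , ordy , m∣k)) px
    with q , j , qq , (_ , yq , _) ← eppo y
    with refl ← pElement-prime-unique pp qq x≉e px
                  (j , ↑-∣ (∣-trans m∣k (order-∣ {n = q ^ j} ordy yq)) xᵐ) = j , yq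

  Γ : SimpleGraph c ℓ ℓ
  Γ = OrderSupergraph G

  adjacent-ε : ∀ {x} → ¬ (x ≈ ε) → Adjacent G x ε
  adjacent-ε {x} x≉e with q , k , qq , ord ← eppo x =
    x≉e , inj₂ (1 , q ^ k , (z<s , ↑1 ε , λ _ m>0 _ → m>0) , ord , 1∣ (q ^ k))

  module _ {S : Subset setoid} where

    joined-sym : ∀ {x y} → Joined (Γ ─ S) x y → Joined (Γ ─ S) y x
    joined-sym = reverse (Sum.map ≈-sym (adjacent-sym G))

    ε∉⇒joined : ε ∉ S → ∀ x y → Joined (Γ ─ S) x y
    ε∉⇒joined e∉ x y = to-ε x ◅◅ joined-sym (to-ε y)
      where
      to-ε : ∀ x → Joined (Γ ─ S) x (ε , e∉)
      to-ε (x , _) with x ≟ ε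
      ... | yes x≈e = inj₁ x≈e ◅ nil
      ... | no  x≉e = inj₂ (adjacent-ε x≉e) ◅ nil

    ∉⇒≉ε : ε ∈ S → ∀ {x} → x ∉ S → ¬ (x ≈ ε)
    ∉⇒≉ε e∈ x∉ x≈e = x∉ (∈-resp S (≈-sym x≈e) e∈)

    joined⇒same-prime : ε ∈ S → ∀ {p x y} → Prime p → Joined (Γ ─ S) x y →
                        PElement p (proj₁ x) → PElement p (proj₁ y)
    joined⇒same-prime e∈ pp nil                          px = px
    joined⇒same-prime e∈ pp (inj₁ x≈y ◅ ys)              px = joined⇒same-prime e∈ pp ys (pElement-resp x≈y px)
    joined⇒same-prime e∈ pp (_◅_ {x , x∉} (inj₂ x~y) ys) px =
      joined⇒same-prime e∈ pp ys (adjacent⇒same-prime pp (∉⇒≉ε e∈ x∉) x~y px)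

    same-prime⇒joined : ∀ {p x y} → Prime p → PElement p (proj₁ x) → PElement p (proj₁ y) →
                        Joined (Γ ─ S) x y
    same-prime⇒joined {x = x , _} {y , _} pp px py with x ≟ y
    ... | yes x≈y = inj₁ x≈y ◅ nil
    ... | no  x≉y = inj₂ (same-prime⇒adjacent pp px py x≉y) ◅ nil

    -- The first three vertices of the cycle serve: they are distinct, they carry the prime of x
    -- along the joining paths, and they differ from ε, which has been removed.
    cycle⇒threePElements : ε ∈ S → ∀ {p x} → Prime p → PElement p (proj₁ x) →
                           ComponentContainsCycle (Γ ─ S) x → ThreePElements p
    cycle⇒threePElements e∈ pp px (C , joined) =
      (λ i → proj₁ (v (i Fin.↑ˡ k))) ,
      ◂-injective (λ i e≈ → ∉⇒≉ε e∈ (proj₂ (v (i Fin.↑ˡ k))) (≈-sym e≈))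
        (λ eq → Fin.↑ˡ-injective k _ _ (distinct eq)) ,
      λ i → joined⇒same-prime e∈ pp (joined (i Fin.↑ˡ k)) px
      where open Cycle C

  -- The pivot of the equivalence: separability and the arithmetic conditions are each compared with
  -- it.
  TwoPrimes : Set _
  TwoPrimes = ∃[ p ] ∃[ q ] Prime p × Prime q × p ≢ q × ThreePElements p × ThreePElements q

  separable⇒twoPrimes : CyclicallySeparable Γ → TwoPrimes
  separable⇒twoPrimes (S , _ , x , y , ¬joined , cycle-x , cycle-y)
    with e∈ ← decidable-stable (T? (Func.to S ε)) (λ e∉ → ¬joined (ε∉⇒joined {S} e∉ x y))
    with p , i , pp , ordx ← eppo (proj₁ x) | q , j , qq , ordy ← eppo (proj₁ y) =
    p , q , pp , qq ,
    (λ { refl → ¬joined (same-prime⇒joined {S} pp px py) }) ,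
    cycle⇒threePElements {S} e∈ pp px cycle-x , cycle⇒threePElements {S} e∈ qq py cycle-y
    where
    px = order⇒pElement (i , ordx)
    py = order⇒pElement (j , ordy)

  -- The cutset is the identity alone. Three p-elements form a triangle, and so do three q-elements;
  -- a path between the triangles would make a non-identity q-element a p-element.
  twoPrimes⇒separable : TwoPrimes → CyclicallySeparable Γ
  twoPrimes⇒separable (p , q , pp , qq , p≢q , P , Q) =
    ⟨ε⟩ , (vertex P zero , vertex Q zero , ¬joined) ,
    (vertex P zero , vertex Q zero , ¬joined , triangle pp P , triangle qq Q)
    where
    nontrivial : ∀ {r} (R : ThreePElements r) i → ¬ (proj₁ R i ≈ ε)
    nontrivial (v , inj , _) i vi≈e = contradiction (inj {suc i} {zero} vi≈e) λ ()

    vertex : ∀ {r} → ThreePElements r → Fin 3 → Σ Carrier (_∉ ⟨ε⟩)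
    vertex R i = proj₁ R i , λ vi∈ → nontrivial R i (∈⟨ε⟩⁻ vi∈)

    triangle : ∀ {r} → Prime r → (R : ThreePElements r) →
               ComponentContainsCycle (Γ ─ ⟨ε⟩) (vertex R zero)
    triangle rr R@(v , inj , rv) = record
      { k        = 0
      ; v        = vertex R
      ; distinct = λ eq → Fin.suc-injective (inj eq)
      ; step     = λ { zero → edge zero (suc zero) λ () ; (suc zero) → edge (suc zero) (suc (suc zero)) λ () }
      ; close    = edge (suc (suc zero)) zero λ ()
      } , λ i → same-prime⇒joined {⟨ε⟩} rr (rv zero) (rv i)
      where
      edge : ∀ i j → i ≢ j → Adjacent G (v i) (v j)
      edge i j i≢j = same-prime⇒adjacent rr (rv i) (rv j) (λ eq → i≢j (Fin.suc-injective (inj eq)))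

    ¬joined : ¬ Joined (Γ ─ ⟨ε⟩) (vertex P zero) (vertex Q zero)
    ¬joined joined = p≢q (pElement-prime-unique pp qq (nontrivial Q zero)
      (joined⇒same-prime {⟨ε⟩} (∈⟨ε⟩⁺ ≈-refl) pp joined (proj₂ (proj₂ P) zero))
      (proj₂ (proj₂ Q) zero))

-- Case distinction on the two primes and the final equivalence

prime-cases : ∀ {p} → Prime p → p ≥ 5 ⊎ p ≡ 3 ⊎ p ≡ 2
prime-cases {0} pp = contradiction pp ¬prime[0]
prime-cases {1} pp = contradiction pp ¬prime[1]
prime-cases {2} pp = inj₂ (inj₂ refl)
prime-cases {3} pp = inj₂ (inj₁ refl)
prime-cases {4} pp = contradiction pp (toWitnessFalse {a? = prime? 4} tt)
prime-cases {suc (suc (suc (suc (suc p))))} pp = inj₁ (ℕ.m≤m+n 5 p)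

distinct-primes-∣ : ∀ {p q n} → Prime p → Prime q → p ≢ q → p ∣ n → q ∣ n → p * q ∣ n
distinct-primes-∣ {p} {q} pp qq p≢q p∣n (divides-refl m) with euclidsLemma m q pp p∣n
... | inj₁ p∣m = *-monoˡ-∣ q p∣m
... | inj₂ p∣q = contradiction (prime∣prime⇒≡ pp qq p∣q) p≢q

mainTheorem3 : ∀ {c ℓ} (G : Group c ℓ) (∣G∣ : ℕ) →
    HasCardinality (Group.setoid G) ∣G∣ →
    EPPO G →
    CyclicallySeparable (OrderSupergraph G) ⇔
    ((∃[ p ] ∃[ q ] Prime p × Prime q × p > q × q ≥ 5 × p * q ∣ ∣G∣)
    ⊎
    AtLeastTwo
    (∃[ p ] Prime p × p ≥ 5 × p ∣ ∣G∣)
    (3 ∣ ∣G∣ × ∃[ P ] IsSylow G 3 P × (¬ HasCardinality ⟦ P ⟧ 3 ⊎ ¬ IsNormal G P))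
    (2 ∣ ∣G∣ × ∃[ P ] IsSylow G 2 P × (¬ HasCardinality ⟦ P ⟧ 2 ⊎ ¬ IsNormal G P)))
mainTheorem3 G ∣G∣ card eppo = mk⇔ (necessary ∘ separable⇒twoPrimes) (twoPrimes⇒separable ∘ sufficient)
  where
  open FiniteEPPO G card eppo

  Conditions : Set _
  Conditions =
    (∃[ p ] ∃[ q ] Prime p × Prime q × p > q × q ≥ 5 × p * q ∣ ∣G∣) ⊎
    AtLeastTwo (∃[ p ] Prime p × p ≥ 5 × p ∣ ∣G∣) (SylowCondition 3) (SylowCondition 2)

  two-large : ∀ {p q} → Prime p → Prime q → p ≢ q → p ≥ 5 → q ≥ 5 → p ∣ ∣G∣ → q ∣ ∣G∣ → Conditions
  two-large {p} {q} pp qq p≢q p≥5 q≥5 p∣ q∣ with ℕ.<-cmp p q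
  ... | tri< p<q _ _ = inj₁ (q , p , qq , pp , p<q , p≥5 , distinct-primes-∣ qq pp (p≢q ∘ ≡.sym) q∣ p∣)
  ... | tri≈ _ p≡q _ = contradiction p≡q p≢q
  ... | tri> _ _ q<p = inj₁ (p , q , pp , qq , q<p , q≥5 , distinct-primes-∣ pp qq p≢q p∣ q∣)

  necessary : TwoPrimes → Conditions
  necessary (p , q , pp , qq , p≢q , P , Q) with prime-cases pp | prime-cases qq
  ... | inj₁ p≥5         | inj₁ q≥5         =
    two-large pp qq p≢q p≥5 q≥5 (threePElements⇒∣ pp P) (threePElements⇒∣ qq Q)
  ... | inj₁ p≥5         | inj₂ (inj₁ refl) =
    -- In these cases `ℕ.m≤m+n 4 0` is a proof of 3 < 4 and `ℕ.m≤m+n 3 1` one of 2 < 4, the bound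
    -- behind the pigeonhole argument.
    inj₂ (inj₁ ((p , pp , p≥5 , threePElements⇒∣ pp P) , threePElements⇒sylowCondition qq (ℕ.m≤m+n 4 0) Q))
  ... | inj₁ p≥5         | inj₂ (inj₂ refl) =
    inj₂ (inj₂ (inj₁ ((p , pp , p≥5 , threePElements⇒∣ pp P) , threePElements⇒sylowCondition qq (ℕ.m≤m+n 3 1) Q)))
  ... | inj₂ (inj₁ refl) | inj₁ q≥5         =
    inj₂ (inj₁ ((q , qq , q≥5 , threePElements⇒∣ qq Q) , threePElements⇒sylowCondition pp (ℕ.m≤m+n 4 0) P))
  ... | inj₂ (inj₂ refl) | inj₁ q≥5         =
    inj₂ (inj₂ (inj₁ ((q , qq , q≥5 , threePElements⇒∣ qq Q) , threePElements⇒sylowCondition pp (ℕ.m≤m+n 3 1) P)))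
  ... | inj₂ (inj₁ refl) | inj₂ (inj₁ refl) = contradiction refl p≢q
  ... | inj₂ (inj₁ refl) | inj₂ (inj₂ refl) =
    inj₂ (inj₂ (inj₂ (threePElements⇒sylowCondition pp (ℕ.m≤m+n 4 0) P , threePElements⇒sylowCondition qq (ℕ.m≤m+n 3 1) Q)))
  ... | inj₂ (inj₂ refl) | inj₂ (inj₁ refl) =
    inj₂ (inj₂ (inj₂ (threePElements⇒sylowCondition qq (ℕ.m≤m+n 4 0) Q , threePElements⇒sylowCondition pp (ℕ.m≤m+n 3 1) P)))
  ... | inj₂ (inj₂ refl) | inj₂ (inj₂ refl) = contradiction refl p≢q

  sufficient : Conditions → TwoPrimes
  sufficient (inj₁ (p , q , pp , qq , p>q , q≥5 , pq∣)) =
    p , q , pp , qq , (λ p≡q → ℕ.<⇒≢ p>q (≡.sym p≡q)) ,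
    three-p-elements pp (ℕ.≤-trans q≥5 (ℕ.<⇒≤ p>q)) (m*n∣⇒m∣ p q pq∣) ,
    three-p-elements qq q≥5 (m*n∣⇒n∣ p q pq∣)
  sufficient (inj₂ (inj₁ ((p , pp , p≥5 , p∣) , cond₃))) =
    p , 3 , pp , prime[3] , (λ { refl → contradiction p≥5 λ { (s≤s (s≤s (s≤s ()))) } }) ,
    three-p-elements pp p≥5 p∣ , sylowCondition-3⇒ cond₃
  sufficient (inj₂ (inj₂ (inj₁ ((p , pp , p≥5 , p∣) , cond₂)))) =
    p , 2 , pp , prime[2] , (λ { refl → contradiction p≥5 λ { (s≤s (s≤s ())) } }) ,
    three-p-elements pp p≥5 p∣ , sylowCondition-2⇒ cond₂
  sufficient (inj₂ (inj₂ (inj₂ (cond₃ , cond₂)))) =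
    3 , 2 , prime[3] , prime[2] , (λ ()) , sylowCondition-3⇒ cond₃ , sylowCondition-2⇒ cond₂
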